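{- For $k\ge i\ge1$ and integers $N_1\ge N_2\ge\cdots\ge N_{k-1}\ge0$, there is a bijection $\Theta:\mathbb{G}_{N_1,\dots,N_{k-1};i}\to\mathbb{D}_{N_1}\times\mathbb{E}_{N_1,\dots,N_{k-1};i}$ such that whenever $\Theta(\mu)=(\eta,\nu)$ we have $|\mu|=|\eta|+|\nu|$.
   Context: An overpartition of $n$ is a partition of $n$ in which the first occurrence of each part size may be overlined. Parts are ordered by $\overline1<1<\overline2<2<\cdots$, and an overpartition is written $\lambda=(\lambda_1,\dots,\lambda_\ell)$ with $\lambda_1\le\cdots\le\lambda_\ell$ in this order; $|\lambda_j|$ is the numerical size of a part, $|\lambda|=\sum_j|\lambda_j|$. For $t\ge1$, $f_t(\lambda)$ (resp. $f_{\overline t}(\lambda)$) is the number of non-overlined (resp. overlined) parts equal to $t$; $f_0=f_{\overline0}=0$. Göllnitz–Gordon marking: marks are assigned to $\lambda_1,\dots,\lambda_\ell$ in this order; $\lambda_1$ gets mark $1$. For $p>1$: (a) a non-overlined odd $\lambda_p$ gets mark $1$; (b) an overlined even $\lambda_p$ gets mark $1$; (c) an overlined odd $\lambda_p$ gets the least positive integer not used as the mark of any $\lambda_j$ ($j<p$) with $|\lambda_p|-|\lambda_j|=1$; (d) if $\lambda_p=2t+2$ is non-overlined even, let $f$ be the least positive integer not used as the mark of any $\lambda_j$ ($j<p$) with $|\lambda_p|-|\lambda_j|\le2$, and $g$ the least positive integer used as the mark of some $\lambda_j$ ($j<p$) with $|\lambda_p|-|\lambda_j|=2$ ($g=0$ if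 none); if simultaneously (i) $g\ge2$, (ii) the mark of $\lambda_{p-1}$ is $g-1$, (iii) a non-overlined $2t+1$ or an $\overline{2t+2}$ occurs in $\lambda$, (iv) $\overline{2t+1}$ does not occur in $\lambda$, then $\lambda_p$ gets mark $g$, otherwise mark $f$. A part with mark $r$ is $r$-marked. $\mathbb{O}_{k,i}(m,n)$: overpartitions of $n$ with exactly $m$ parts such that (1) $f_{\overline1}+f_2\le i-1$; (2) $f_{\overline{2t}}+f_{2t}+f_{\overline{2t+1}}+f_{2t+2}\le k-1$ for all $t\ge0$; (3) for all $t\ge0$, $f_{2t+1}\ge1$ implies $f_{2t+2}\le k-2$. $\mathbb{F}_{k,i}(m,n)$: those $\lambda\in\mathbb{O}_{k,i}(m,n)$ whose smallest part is an overlined odd part or a non-overlined even part. $\mathbb{F}_{N_1,\dots,N_{k-1};i}$: the set of $\lambda\in\bigcup_{n}\mathbb{F}_{k,i}(N_1+\cdots+N_{k-1},n)$ having exactly $N_r$ $r$-marked parts for each $1\le r\le k-1$. $\mathbb{G}_{N_1,\dots,N_{k-1};i}$: those elements of $\mathbb{F}_{N_1,\dots,N_{k-1};i}$ with no overlined even parts and no non-overlined odd parts. $\mathbb{E}_{N_1,\dots,N_{k-1};i}$: those elements of $\mathbb{G}_{N_1,\dots,N_{k-1};i}$ with no overlined odd parts. For $N\ge0$, $\mathbb{D}_N$ is the set of partitions $\eta=(\eta_1<\cdots<\eta_\ell)$ into distinct negative odd integers in $[1-2N,-1]$, with $|\eta|=\eta_1+\cdots+\eta_\ell$ (so $\sum_{\eta\in\mathbb{D}_N}q^{|\eta|}=(-q^{1-2N};q^2)_N$).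 -}

module Defs where

open import Data.Bool using (Bool; true; false; T; _∧_; _∨_; not; if_then_else_)
open import Data.Nat using (ℕ; zero; suc; _+_; _*_; _∸_; _≤_; _<_; _%_; _≡ᵇ_; _≤ᵇ_; _⊓_)
open import Data.List using (List; []; _∷_; length; foldr; map)
open import Data.List.Relation.Unary.All using (All)
open import Data.List.Relation.Unary.Linked using (Linked)
open import Data.Vec using (Vec; lookup)
import Data.Vec as Vec
open import Data.Fin using (Fin; toℕ)
import Data.Fin as Fin
open import Data.Integer as ℤ using (ℤ; +_; -[1+_])
open import Data.Product using (Σ; _×_; _,_; proj₁; proj₂)
open import Data.Sum using (_⊎_)
open import Relation.Binary.PropositionalEquality using (_≡_)

-- Overpartitions.
-- A part is a size (a positive integer) together with a flag saying
-- whether it is overlined.  The order  1̄ < 1 < 2̄ < 2 < ...  is the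
-- order of the numbers  key p  (1, 2, 3, 4, ...).
-- An overpartition is represented canonically as the list
-- (λ₁, ..., λ_ℓ) of its parts in non-decreasing order, where only the
-- first occurrence of a size may be overlined (so an overlined part is
-- strictly smaller than the next part).

record Part : Set where
  constructor part
  field
    size : ℕ
    over : Bool
open Part public

key : Part → ℕ
key (part s true)  = 2 * s ∸ 1
key (part s false) = 2 * s

AdjOK : Part → Part → Set
AdjOK p q = key p ≤ key q × (over p ≡ true → key p < key q)

IsOverpartition : List Part → Set
IsOverpartition λs = All (λ p → 1 ≤ size p) λs × Linked AdjOK λs

∣_∣ₚ : List Part → ℕ
∣ λs ∣ₚ = foldr (λ p n → size p + n) 0 λs

isOdd : ℕ → Bool
isOdd s = s % 2 ≡ᵇ 1

isEven : ℕ → Bool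
isEven s = s % 2 ≡ᵇ 0

count : {A : Set} → (A → Bool) → List A → ℕ
count P []       = 0
count P (x ∷ xs) = if P x then suc (count P xs) else count P xs

fN : ℕ → List Part → ℕ
fN t = count (λ p → (size p ≡ᵇ t) ∧ not (over p))

fO : ℕ → List Part → ℕ
fO t = count (λ p → (size p ≡ᵇ t) ∧ over p)
-- (For an overpartition all sizes are ≥ 1, so f_0 = f_{0̄} = 0.)

anyᵇ : {A : Set} → (A → Bool) → List A → Bool
anyᵇ P []       = false
anyᵇ P (x ∷ xs) = P x ∨ anyᵇ P xs

filterᵇ : {A : Set} → (A → Bool) → List A → List A
filterᵇ P []       = []
filterᵇ P (x ∷ xs) = if P x then x ∷ filterᵇ P xs else filterᵇ P xs

elemℕ : ℕ → List ℕ → Bool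
elemℕ r S = anyᵇ (r ≡ᵇ_) S

leastNotIn : List ℕ → ℕ
leastNotIn S = go (length S) 1
  where
  go : ℕ → ℕ → ℕ
  go zero       r = r
  go (suc fuel) r = if elemℕ r S then go fuel (suc r) else r

leastPosIn : List ℕ → ℕ
leastPosIn S with filterᵇ (1 ≤ᵇ_) S
... | []     = 0
... | x ∷ xs = foldr _⊓_ x xs

partEq : Part → Part → Bool
partEq (part s true)  (part s' b) = (s ≡ᵇ s') ∧ b
partEq (part s false) (part s' b) = (s ≡ᵇ s') ∧ not b

occurs : Part → List Part → Bool
occurs p λs = anyᵇ (partEq p) λs

marksAtDist : ℕ → ℕ → List (Part × ℕ) → List ℕ
marksAtDist s d prev =
  map proj₂ (filterᵇ (λ qm → s ≡ᵇ size (proj₁ qm) + d) prev)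

-- marks of the earlier parts λ_j with  |λ_p| - |λ_j| ≤ 2
-- (|λ_j| ≤ |λ_p| holds automatically since parts are sorted)
marksWithin2 : ℕ → List (Part × ℕ) → List ℕ
marksWithin2 s prev =
  map proj₂ (filterᵇ (λ qm → s ≤ᵇ size (proj₁ qm) + 2) prev)

-- mark of λ_p (p > 1).  `whole` is λ, `prev` lists the pairs (λ_j, mark)
-- for j < p, most recent first (so its head is λ_{p-1}), `lastMark` is
-- the mark of λ_{p-1}.
markOf : List Part → List (Part × ℕ) → ℕ → Part → ℕ
markOf whole prev lastMark (part s false) =
  if isOdd s then 1
  else
    (if (2 ≤ᵇ g) ∧ (lastMark ≡ᵇ g ∸ 1)
          ∧ (occurs (part (s ∸ 1) false) whole ∨ occurs (part s true) whole)
          ∧ not (occurs (part (s ∸ 1) true) whole)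
     then g else f)
  where
  f = leastNotIn (marksWithin2 s prev)
  g = leastPosIn (marksAtDist s 2 prev)
markOf whole prev lastMark (part s true) =
  if isEven s then 1
  else leastNotIn (marksAtDist s 1 prev)

marks : List Part → List ℕ
marks whole = go [] 0 whole
  where
  go : List (Part × ℕ) → ℕ → List Part → List ℕ
  go prev lastMark [] = []
  go [] lastMark (p ∷ ps) = 1 ∷ go ((p , 1) ∷ []) 1 ps
  go prev@(_ ∷ _) lastMark (p ∷ ps) =
    let m = markOf whole prev lastMark p in m ∷ go ((p , m) ∷ prev) m ps

markCount : ℕ → List Part → ℕ
markCount r λs = count (r ≡ᵇ_) (marks λs)

InO : ℕ → ℕ → List Part → Set
InO k i λs =
    (fO 1 λs + fN 2 λs + 1 ≤ i)
  × (∀ t → fO (2 * t) λs + fN (2 * t) λs + fO (2 * t + 1) λs + fN (2 * t + 2) λs + 1 ≤ k)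
  × (∀ t → 1 ≤ fN (2 * t + 1) λs → fN (2 * t + 2) λs + 2 ≤ k)

overOdd : Part → Bool
overOdd p = over p ∧ isOdd (size p)

plainEven : Part → Bool
plainEven p = not (over p) ∧ isEven (size p)

SmallestOK : List Part → Set
SmallestOK []      = Data.Unit.⊤
  where import Data.Unit
SmallestOK (p ∷ _) = T (overOdd p ∨ plainEven p)

-- N_1 (taken to be 0 when k = 1, i.e. when there are no N_r)
N₁ : {m : ℕ} → Vec ℕ m → ℕ
N₁ Vec.[]      = 0
N₁ (n Vec.∷ _) = n

-- N_1 ≥ N_2 ≥ ... ≥ N_{k-1}   (index r : Fin (k-1) stands for N_{r+1})
Antitone : {m : ℕ} → Vec ℕ m → Set
Antitone {m} N = ∀ (r s : Fin m) → r Fin.≤ s → lookup N s ≤ lookup N r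

InF : (k i : ℕ) → Vec ℕ (k ∸ 1) → List Part → Set
InF k i N λs =
    IsOverpartition λs
  × InO k i λs
  × SmallestOK λs
  × (length λs ≡ Vec.sum N)
  × (∀ (r : Fin (k ∸ 1)) → markCount (suc (toℕ r)) λs ≡ lookup N r)

InG : (k i : ℕ) → Vec ℕ (k ∸ 1) → List Part → Set
InG k i N λs = InF k i N λs × All (λ p → T (overOdd p ∨ plainEven p)) λs

InE : (k i : ℕ) → Vec ℕ (k ∸ 1) → List Part → Set
InE k i N λs = InG k i N λs × All (λ p → T (plainEven p)) λs

-- 𝔻_N : partitions η = (η₁ < ... < η_ℓ) into distinct negative odd
-- integers in [1-2N, -1], i.e. each η_j = -(2a+1) with a < N.

InD : ℕ → List ℤ → Set
InD N η = Linked ℤ._<_ η × All (λ x → Σ ℕ (λ a → a < N × x ≡ -[1+ 2 * a ])) η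

∣_∣ᵢ : List ℤ → ℤ
∣ η ∣ᵢ = foldr ℤ._+_ (+ 0) η

{-# OPTIONS --safe #-}

-- Record an element of 𝔾 as the sequence of pairs (g , f), where g says whether the overlined
-- part 2t+1 occurs and f is the multiplicity of 2t+2.  On 𝔾 every part gets the least mark not
-- used in its window, so if c parts of the window are marked ≤ r, then as many of the next
-- parts as there is room for, that is at most r − c, are marked ≤ r again.  Hence the number
-- of parts marked ≤ r is given by a truncated-sum recursion (load) which ignores the marks.
--
-- Cut a sequence of multiplicities greedily from the left into pairs of neighbouring positions
-- (s , s+1), each starting at a nonzero entry; the pairs are headed by the 1-marked parts.
-- Moving one unit from s to s+1 in every pair adds 2 to the weight for each pair and is undone
-- by the greedy cut from the right.  To remove the largest overlined part 2t+1, turn it into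
-- 2t+2 and move a unit in each of the a pairs above it.  No mark count changes, the weight
-- grows by 2a+1, and -(2a+1) is recorded in η.  Repeating this from the top down gives strictly
-- increasing values of a, the last one being less than N₁.
module Submission where

open import Defs
open import Data.Bool using (Bool; true; false; T; _∧_; _∨_; not)
open import Data.Bool.Properties using (∧-zeroʳ; T-≡; ¬-not)
open import Data.Fin as Fin using (Fin; toℕ)
open import Data.List using (List; []; _∷_; _++_; length; map; replicate)
open import Data.List.Properties using (∷-injective; ∷-injectiveˡ; ∷-injectiveʳ; length-++; length-replicate; ++-cancelˡ; map-injective)
open import Data.List.Relation.Unary.All as All using (All; []; _∷_)
import Data.List.Relation.Unary.All.Properties as All
open import Data.List.Relation.Unary.AllPairs as AllPairs using (AllPairs; []; _∷_)
import Data.List.Relation.Unary.AllPairs.Properties as AllPairs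
open import Data.List.Relation.Unary.Linked.Properties using (Linked⇒AllPairs; AllPairs⇒Linked)
open import Data.Nat using (ℕ; zero; suc; _+_; _*_; _∸_; _⊓_; _≤_; _<_; _>_; z≤n; s≤s; _<?_; _≟_; _≡ᵇ_; _≤ᵇ_)
open import Data.Nat.ListAction using (sum)
open import Data.Nat.Properties
open import Algebra.Properties.CommutativeSemigroup +-commutativeSemigroup using (interchange)
open import Data.Nat.Tactic.RingSolver using (solve-∀)
open import Data.Product using (Σ; ∃; _×_; _,_; proj₁; proj₂)
open import Data.Sum using (_⊎_; inj₁; inj₂)
open import Data.Unit using (⊤; tt)
open import Data.Vec as Vec using (Vec; lookup)
open import Function using (_∘_; _∋_)
open import Function.Bundles using (Equivalence)
open import Relation.Binary.PropositionalEquality using (_≡_; _≢_; refl; sym; trans; cong; cong₂; subst; module ≡-Reasoning)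
open import Relation.Nullary using (¬_; yes; no; contradiction)

-- Pairs and the bijection on sequences

pairs : List ℕ → ℕ
pairs []                = 0
pairs (zero ∷ v)        = pairs v
pairs (suc _ ∷ [])      = 1
pairs (suc _ ∷ _ ∷ v)   = suc (pairs v)

shift : List ℕ → List ℕ
shift []                = []
shift (zero ∷ v)        = zero ∷ shift v
shift (suc p ∷ [])      = p ∷ 1 ∷ []
shift (suc p ∷ q ∷ v)   = p ∷ suc q ∷ shift v

Config : Set
Config = List (Bool × ℕ)

plain : List ℕ → Config
plain = map (false ,_)

θ : Config → List ℕ × List ℕ
θ []                = [] , []
θ ((false , f) ∷ x) = proj₁ (θ x) , f ∷ proj₂ (θ x)
θ ((true  , f) ∷ x) = pairs (proj₂ (θ x)) ∷ proj₁ (θ x) , suc f ∷ shift (proj₂ (θ x))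

-- A nonzero entry placed before a shifted sequence displaces the cut by one position: the right
-- half of each old pair, nonzero after the shift, starts a new one. `pairs-shift` needs this as
-- soon as a left half has dropped to 0, since the cut then restarts at the right half.
pairs-suc∷shift : ∀ f v → pairs (suc f ∷ shift v) ≡ suc (pairs v)
pairs-shift     : ∀ v → pairs (shift v) ≡ pairs v

pairs-suc∷shift f []              = refl
pairs-suc∷shift f (zero ∷ v)      = cong suc (pairs-shift v)
pairs-suc∷shift f (suc p ∷ [])    = refl
pairs-suc∷shift f (suc p ∷ q ∷ v) = cong suc (pairs-suc∷shift q v)

pairs-shift []                  = refl
pairs-shift (zero ∷ v)          = pairs-shift v
pairs-shift (suc zero ∷ [])     = refl
pairs-shift (suc (suc p) ∷ [])  = refl
pairs-shift (suc zero ∷ q ∷ v)  = pairs-suc∷shift q v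
pairs-shift (suc (suc p) ∷ q ∷ v) = cong suc (pairs-shift v)

-- The cuts with and without the first entry interlace: if both `f` and the head of `v` start a
-- pair, then after one pair each the same comparison is left, with `q` in the role of `f`.
pairs-∷ : ∀ f v → pairs v ≤ pairs (f ∷ v) × pairs (f ∷ v) ≤ suc (pairs v)
pairs-∷ zero    v             = ≤-refl , n≤1+n _
pairs-∷ (suc f) []            = z≤n , ≤-refl
pairs-∷ (suc f) (zero ∷ v)    = n≤1+n _ , ≤-refl
pairs-∷ (suc f) (suc p ∷ [])  = ≤-refl , n≤1+n _
pairs-∷ (suc f) (suc p ∷ q ∷ v) = s≤s (proj₁ (pairs-∷ q v)) , s≤s (proj₂ (pairs-∷ q v))

-- Removing an overlined part records the current number of pairs and, by `pairs-suc∷shift`, raises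
-- that number by exactly one. So each new value exceeds all those recorded before it and stays
-- below the new pair count.
θ-< : ∀ x → All (_< pairs (proj₂ (θ x))) (proj₁ (θ x))
θ-< []                = []
θ-< ((false , f) ∷ x) = All.map (λ a< → ≤-trans a< (proj₁ (pairs-∷ f _))) (θ-< x)
θ-< ((true  , f) ∷ x) = subst (λ n → All (_< n) _) (sym (pairs-suc∷shift f (proj₂ (θ x))))
  (≤-refl ∷ All.map m≤n⇒m≤1+n (θ-< x))

θ-decreasing : ∀ x → AllPairs _>_ (proj₁ (θ x))
θ-decreasing []                = []
θ-decreasing ((false , f) ∷ x) = θ-decreasing x
θ-decreasing ((true  , f) ∷ x) = θ-< x ∷ θ-decreasing x

-- No trailing z, so that a sequence is determined by its parts.
Trimmed : {A : Set} → A → List A → Set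
Trimmed z []       = ⊤
Trimmed z (x ∷ xs) = (xs ≡ [] → x ≢ z) × Trimmed z xs

shift≡[] : ∀ v → shift v ≡ [] → v ≡ []
shift≡[] []              eq = refl
shift≡[] (zero ∷ v)      ()
shift≡[] (suc p ∷ [])    ()
shift≡[] (suc p ∷ q ∷ v) ()

shift-trimmed : ∀ v → Trimmed 0 v → Trimmed 0 (shift v)
shift-trimmed []              tv         = tt
shift-trimmed (zero ∷ v)      (z , tv)   = (λ eq → z (shift≡[] v eq)) , shift-trimmed v tv
shift-trimmed (suc p ∷ [])    tv         = (λ ()) , (λ _ ()) , tt
shift-trimmed (suc p ∷ q ∷ v) (_ , _ , tv) = (λ ()) , (λ _ ()) , shift-trimmed v tv

θ≡[] : ∀ x → proj₂ (θ x) ≡ [] → x ≡ []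
θ≡[] []                eq = refl
θ≡[] ((false , f) ∷ x) ()
θ≡[] ((true  , f) ∷ x) ()

θ-trimmed : ∀ x → Trimmed (false , 0) x → Trimmed 0 (proj₂ (θ x))
θ-trimmed []                tx       = tt
θ-trimmed ((false , f) ∷ x) (z , tx) = (λ eq f≡0 → z (θ≡[] x eq) (cong (false ,_) f≡0)) , θ-trimmed x tx
θ-trimmed ((true  , f) ∷ x) (z , tx) = (λ _ ()) , shift-trimmed _ (θ-trimmed x tx)

-- The two outcomes of the greedy cut from the right exclude each other. Comparing tails gives the
-- same equation with the two sides exchanged and shorter sequences.
shift≢suc∷shift : ∀ v q v′ → shift v ≢ suc q ∷ shift v′
shift≢suc∷shift (suc p ∷ [])    q []              ()
shift≢suc∷shift (suc p ∷ [])    q (zero ∷ v′)     ()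
shift≢suc∷shift (suc p ∷ [])    q (suc r ∷ [])    ()
shift≢suc∷shift (suc p ∷ [])    q (suc r ∷ _ ∷ _) ()
shift≢suc∷shift (suc p ∷ r ∷ v) q v′ eq = shift≢suc∷shift v′ r v (sym (∷-injectiveʳ eq))

shift-injective : ∀ v v′ → Trimmed 0 v → Trimmed 0 v′ → shift v ≡ shift v′ → v ≡ v′
shift-injective [] v′ _ _ eq = sym (shift≡[] v′ (sym eq))
shift-injective v@(_ ∷ _) [] _ _ eq = shift≡[] v eq
shift-injective (zero ∷ v) (zero ∷ v′) (_ , t) (_ , t′) eq =
  cong (zero ∷_) (shift-injective v v′ t t′ (∷-injectiveʳ eq))
shift-injective (zero ∷ v) (suc p ∷ []) _ _ eq =
  contradiction (∷-injectiveʳ eq) (shift≢suc∷shift v 0 [])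
shift-injective (zero ∷ v) (suc p ∷ q ∷ v′) _ _ eq =
  contradiction (∷-injectiveʳ eq) (shift≢suc∷shift v q v′)
shift-injective (suc p ∷ []) (zero ∷ v′) _ _ eq =
  contradiction (sym (∷-injectiveʳ eq)) (shift≢suc∷shift v′ 0 [])
shift-injective (suc p ∷ q ∷ v) (zero ∷ v′) _ _ eq =
  contradiction (sym (∷-injectiveʳ eq)) (shift≢suc∷shift v′ q v)
shift-injective (suc p ∷ []) (suc p′ ∷ []) _ _ eq = cong (λ n → suc n ∷ []) (∷-injectiveˡ eq)
-- `shift` does not distinguish a final `suc p` from a final `suc p` followed by 0; trimming
-- excludes the latter.
shift-injective (suc p ∷ []) (suc p′ ∷ q ∷ v′) _ (_ , t , _) eq with ∷-injective (∷-injectiveʳ eq)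
... | 1≡ , []≡ = contradiction (sym (suc-injective 1≡)) (t (shift≡[] v′ (sym []≡)))
shift-injective (suc p ∷ q ∷ v) (suc p′ ∷ []) (_ , t , _) _ eq with ∷-injective (∷-injectiveʳ eq)
... | 1≡ , []≡ = contradiction (suc-injective 1≡) (t (shift≡[] v []≡))
shift-injective (suc p ∷ q ∷ v) (suc p′ ∷ q′ ∷ v′) (_ , _ , t) (_ , _ , t′) eq
  with ∷-injective eq
... | refl , eq′ with ∷-injective eq′
... | refl , eq″ = cong (λ w → suc p ∷ q ∷ w) (shift-injective v v′ t t′ eq″)

-- The image shows whether the first position has an overlined part: if so, the first recorded value
-- equals the pair count of the tail of the second component, and otherwise all recorded values are
-- less than that count.
θ-head≢ : ∀ x y f f′ → θ ((true , f) ∷ x) ≢ θ ((false , f′) ∷ y)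
θ-head≢ x y f f′ eq = <-irrefl (sym (pairs-shift (proj₂ (θ x))))
  (subst (pairs (proj₂ (θ x)) <_) (cong pairs (∷-injectiveʳ (sym (cong proj₂ eq))))
    (All.head (subst (All (_< pairs (proj₂ (θ y)))) (sym (cong proj₁ eq)) (θ-< y))))

θ-injective : ∀ x y → Trimmed (false , 0) x → Trimmed (false , 0) y → θ x ≡ θ y → x ≡ y
θ-injective []      y  _ _ eq = sym (θ≡[] y (sym (cong proj₂ eq)))
θ-injective (a ∷ x) [] _ _ eq = θ≡[] (a ∷ x) (cong proj₂ eq)
θ-injective ((true  , f) ∷ x) ((false , f′) ∷ y) _ _ eq = contradiction eq (θ-head≢ x y f f′)
θ-injective ((false , f) ∷ x) ((true  , f′) ∷ y) _ _ eq = contradiction (sym eq) (θ-head≢ y x f′ f)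
θ-injective ((false , f) ∷ x) ((false , f′) ∷ y) (_ , tx) (_ , ty) eq =
  cong₂ (λ n z → (false , n) ∷ z) (∷-injectiveˡ (cong proj₂ eq))
    (θ-injective x y tx ty (cong₂ _,_ (cong proj₁ eq) (∷-injectiveʳ (cong proj₂ eq))))
θ-injective ((true  , f) ∷ x) ((true  , f′) ∷ y) (_ , tx) (_ , ty) eq =
  cong₂ (λ n z → (true , n) ∷ z) (suc-injective (∷-injectiveˡ (cong proj₂ eq)))
    (θ-injective x y tx ty (cong₂ _,_ (∷-injectiveʳ (cong proj₁ eq))
      (shift-injective _ _ (θ-trimmed x tx) (θ-trimmed y ty) (∷-injectiveʳ (cong proj₂ eq)))))

-- In the greedy cut of w from the right, either every pair lies inside w, or the last one
-- found has its right half at the head of w.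
shift-or-suc∷shift : ∀ w → Trimmed 0 w →
    (∃ λ v → Trimmed 0 v × w ≡ shift v)
  ⊎ (∃ λ q → ∃ λ v → Trimmed 0 v × w ≡ suc q ∷ shift v)
shift-or-suc∷shift []      tw       = inj₁ ([] , tt , refl)
shift-or-suc∷shift (h ∷ w) (z , tw) with shift-or-suc∷shift w tw
shift-or-suc∷shift (zero  ∷ w) (z , tw) | inj₁ (v , tv , refl) =
  inj₁ (zero ∷ v , ((λ { refl → z refl }) , tv) , refl)
shift-or-suc∷shift (suc h ∷ w) (z , tw) | inj₁ (v , tv , refl) = inj₂ (h , v , tv , refl)
-- Giving back its unit turns the right half, the last entry, into 0; it is dropped to keep the
-- result trimmed.
shift-or-suc∷shift (h ∷ w) (z , tw) | inj₂ (zero  , []    , tv , refl) =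
  inj₁ (suc h ∷ [] , ((λ _ ()) , tt) , refl)
shift-or-suc∷shift (h ∷ w) (z , tw) | inj₂ (zero  , b ∷ v , tv , refl) =
  inj₁ (suc h ∷ zero ∷ b ∷ v , ((λ ()) , (λ ()) , tv) , refl)
shift-or-suc∷shift (h ∷ w) (z , tw) | inj₂ (suc q , v , tv , refl) =
  inj₁ (suc h ∷ suc q ∷ v , ((λ ()) , (λ _ ()) , tv) , refl)

length-shift : ∀ v → length v ≤ length (shift v)
length-shift []              = z≤n
length-shift (zero ∷ v)      = s≤s (length-shift v)
length-shift (suc p ∷ [])    = s≤s z≤n
length-shift (suc p ∷ q ∷ v) = s≤s (s≤s (length-shift v))

-- Recognises the positions where an overlined part can be restored. If the cut of `w` from the
-- right reached beyond `w`, then prepending a nonzero `h` would not change the number of pairs, by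
-- `pairs-suc∷shift`.
unshift : ∀ h w → Trimmed 0 w → pairs w < pairs (h ∷ w) →
  (∃ λ h′ → h ≡ suc h′) × (∃ λ v → Trimmed 0 v × w ≡ shift v)
unshift zero    w tw lt = contradiction lt (<-irrefl refl)
unshift (suc h) w tw lt with shift-or-suc∷shift w tw
... | inj₁ free = (h , refl) , free
... | inj₂ (q , v , tv , refl) =
  contradiction lt (<-irrefl (trans (pairs-suc∷shift q v) (sym (cong suc (pairs-shift v)))))

-- n bounds the recursion, which passes from shift v to v.
θ-surjective : ∀ n w A → length w ≤ n → Trimmed 0 w → AllPairs _>_ A → All (_< pairs w) A →
  ∃ λ x → Trimmed (false , 0) x × θ x ≡ (A , w)
θ-surjective n []      []      _       _        _         _        = [] , tt , refl
θ-surjective n []      (a ∷ A) _       _        _         (() ∷ _)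
θ-surjective (suc n) (h ∷ w) [] (s≤s l) (z , tw) dec lt with θ-surjective n w [] l tw [] []
... | x , tx , eq = (false , h) ∷ x
    , ((λ { refl h≡0 → z (sym (cong proj₂ eq)) (cong proj₂ h≡0) }) , tx)
    , cong₂ (λ B u → B , h ∷ u) (cong proj₁ eq) (cong proj₂ eq)
-- The head `a` is the largest value. If it is below `pairs w`, all values come from overlined parts
-- at later positions.
θ-surjective (suc n) (h ∷ w) (a ∷ A) (s≤s l) (z , tw) (a> ∷ dec) (a< ∷ lt) with a <? pairs w
... | yes a<w with θ-surjective n w (a ∷ A) l tw (a> ∷ dec) (a<w ∷ All.map (λ b → <-trans b a<w) a>)
...   | x , tx , eq = (false , h) ∷ x
    , ((λ { refl h≡0 → contradiction (cong proj₁ eq) λ () }) , tx)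
    , cong₂ (λ B u → B , h ∷ u) (cong proj₁ eq) (cong proj₂ eq)
-- Otherwise `pairs-∷` forces `a` to equal `pairs w`, and an overlined part is restored at this
-- position.
θ-surjective (suc n) (h ∷ w) (a ∷ A) (s≤s l) (z , tw) (a> ∷ dec) (a< ∷ lt)
    | no a≮w with ≤-antisym (≤-pred (≤-trans a< (proj₂ (pairs-∷ h w)))) (≮⇒≥ a≮w)
... | refl with unshift h w tw a<
... | (h′ , refl) , (v , tv , refl)
  with θ-surjective n v A (≤-trans (length-shift v) l) tv dec (subst (λ m → All (_< m) A) (pairs-shift v) a>)
... | x , tx , eq = (true , h′) ∷ x , ((λ _ ()) , tx)
    , cong₂ _,_ (cong₂ _∷_ (trans (cong (λ e → pairs (proj₂ e)) eq) (sym (pairs-shift v))) (cong proj₁ eq))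
                (cong (λ e → suc h′ ∷ shift (proj₂ e)) eq)

-- Mark counts and weights of sequences

bit : Bool → ℕ
bit false = 0
bit true  = 1

-- The number of parts that get marks ≤ r, when ρ of the marks 1, …, r are not yet used in the
-- window of the first position.
load : ℕ → ℕ → Config → ℕ
load r ρ []            = 0
load r ρ ((g , f) ∷ x) = d + e + load r (r ∸ e) x
  where
  d = bit g ⊓ ρ
  e = f ⊓ (ρ ∸ d)

∸-suc : ∀ {m n} → n < m → m ∸ n ≡ suc (m ∸ suc n)
∸-suc n<m = +-∸-assoc 1 n<m

load-shift     : ∀ r v → load r r (plain (shift v)) ≡ load r r (plain v)
-- A nonzero first entry is counted with room `suc ρ` exactly once more than it is, one unit
-- smaller, with room `ρ`; `load-carry` recovers that unit. A zero entry uses no room, and the next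
-- position starts with room `r` in both cases.
load-suc-shift : ∀ r ρ v → ρ < r → load r ρ (plain (shift v)) ≡ load r (suc ρ) (plain v)
-- The moved unit is counted at the right half instead of the left, as the left half now leaves one
-- more room. The right half in turn leaves one less room to the rest, for which `load-suc-shift`
-- makes up.
load-carry     : ∀ r e q v → e < r →
  e + load r (r ∸ e) (plain (suc q ∷ shift v)) ≡ suc e + load r (r ∸ suc e) (plain (q ∷ v))

load-carry r e q v e<r rewrite ∸-suc e<r = begin
  e + (suc h + load r (r ∸ suc h) (plain (shift v)))     ≡⟨ +-suc e _ ⟩
  suc e + (h + load r (r ∸ suc h) (plain (shift v)))     ≡⟨ cong (λ l → suc e + (h + l)) (load-suc-shift r (r ∸ suc h) v (∸-monoʳ-< {r} {suc h} {0} (s≤s z≤n) h<r)) ⟩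
  suc e + (h + load r (suc (r ∸ suc h)) (plain v))       ≡⟨ cong (λ m → suc e + (h + load r m (plain v))) (∸-suc h<r) ⟨
  suc e + (h + load r (r ∸ h) (plain v))                 ∎
  where
  open ≡-Reasoning
  h = q ⊓ (r ∸ suc e)
  h<r : h < r
  h<r = ≤-<-trans (m⊓n≤n q _) (∸-monoʳ-< {r} {suc e} {0} (s≤s z≤n) e<r)

load-suc-shift r ρ []              ρ<r = refl
load-suc-shift r ρ (zero ∷ v)      ρ<r = load-shift r v
load-suc-shift r ρ (suc p ∷ [])    ρ<r = load-carry r (p ⊓ ρ) 0 [] (≤-<-trans (m⊓n≤n p ρ) ρ<r)
load-suc-shift r ρ (suc p ∷ q ∷ v) ρ<r = load-carry r (p ⊓ ρ) q v (≤-<-trans (m⊓n≤n p ρ) ρ<r)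

load-shift r []              = refl
load-shift r (zero ∷ v)      = load-shift r v
load-shift r (suc p ∷ [])    with p <? r
... | yes p<r rewrite m≤n⇒m⊓n≡m (<⇒≤ p<r) | m≤n⇒m⊓n≡m p<r = load-carry r p 0 [] p<r
-- The left half exhausts all `r` marks with or without the moved unit, so the right half counts
-- nothing and the position after the pair has full room.
... | no  p≮r rewrite m≥n⇒m⊓n≡n (≮⇒≥ p≮r) | m≥n⇒m⊓n≡n (m≤n⇒m≤1+n (≮⇒≥ p≮r)) | n∸n≡0 r = refl
load-shift r (suc p ∷ q ∷ v) with p <? r
... | yes p<r rewrite m≤n⇒m⊓n≡m (<⇒≤ p<r) | m≤n⇒m⊓n≡m p<r = load-carry r p q v p<r
... | no  p≮r rewrite m≥n⇒m⊓n≡n (≮⇒≥ p≮r) | m≥n⇒m⊓n≡n (m≤n⇒m≤1+n (≮⇒≥ p≮r)) | n∸n≡0 r | ⊓-zeroʳ q =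
  cong (r +_) (load-shift r v)

-- An overlined `2t+1` takes no room from the next position, but the `2t+2` replacing it does,
-- provided it is counted at all. The shift of the later entries compensates for this by
-- `load-suc-shift`; if `ρ` is 0, nothing is counted here and `load-shift` applies.
load-θ : ∀ r ρ x → ρ ≤ r → load r ρ (plain (proj₂ (θ x))) ≡ load r ρ x
load-θ r ρ []                ρ≤r = refl
load-θ r ρ ((false , f) ∷ x) ρ≤r = cong (f ⊓ ρ +_) (load-θ r (r ∸ f ⊓ ρ) x (m∸n≤m r (f ⊓ ρ)))
load-θ r zero ((true , f) ∷ x) ρ≤r rewrite ⊓-zeroʳ f =
  trans (load-shift r (proj₂ (θ x))) (load-θ r r x ≤-refl)
load-θ r (suc ρ) ((true , f) ∷ x) ρ<r = cong suc (cong (f ⊓ ρ +_) (begin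
  load r (r ∸ suc (f ⊓ ρ)) (plain (shift v)) ≡⟨ load-suc-shift r _ v (∸-monoʳ-< {r} {suc (f ⊓ ρ)} {0} (s≤s z≤n) e<r) ⟩
  load r (suc (r ∸ suc (f ⊓ ρ))) (plain v)   ≡⟨ cong (λ m → load r m (plain v)) (∸-suc e<r) ⟨
  load r (r ∸ f ⊓ ρ) (plain v)               ≡⟨ load-θ r (r ∸ f ⊓ ρ) x (m∸n≤m r (f ⊓ ρ)) ⟩
  load r (r ∸ f ⊓ ρ) x                       ∎))
  where
  open ≡-Reasoning
  v = proj₂ (θ x)
  e<r : f ⊓ ρ < r
  e<r = ≤-<-trans (m⊓n≤n f ρ) ρ<r

-- With a single mark, a nonzero entry counts once and blocks the next position, which is the greedy
-- cut.
load-1≡pairs : ∀ v → load 1 1 (plain v) ≡ pairs v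
load-1≡pairs []              = refl
load-1≡pairs (zero ∷ v)      = load-1≡pairs v
load-1≡pairs (suc p ∷ [])    rewrite ⊓-zeroʳ p = refl
load-1≡pairs (suc p ∷ q ∷ v) rewrite ⊓-zeroʳ p | ⊓-zeroʳ q = cong suc (load-1≡pairs v)

-- Number of parts, condition (2), and weights

total : Config → ℕ
total []            = 0
total ((g , f) ∷ x) = bit g + f + total x

total-shift : ∀ v → total (plain (shift v)) ≡ total (plain v)
total-shift []              = refl
total-shift (zero ∷ v)      = total-shift v
total-shift (suc p ∷ [])    = +-suc p 0
total-shift (suc p ∷ q ∷ v) = trans (+-suc p _) (cong (λ t → suc (p + (q + t))) (total-shift v))

total-θ : ∀ x → total (plain (proj₂ (θ x))) ≡ total x
total-θ []                = refl
total-θ ((false , f) ∷ x) = cong (f +_) (total-θ x)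
total-θ ((true  , f) ∷ x) = cong (suc f +_) (trans (total-shift (proj₂ (θ x))) (total-θ x))

load≤total : ∀ r ρ x → load r ρ x ≤ total x
load≤total r ρ []            = z≤n
load≤total r ρ ((g , f) ∷ x) =
  +-mono-≤ (+-mono-≤ (m⊓n≤m (bit g) ρ) (m⊓n≤m f _)) (load≤total r _ x)

-- Condition (2) of 𝕆, with the room ρ left at the first position.
Fits : ℕ → ℕ → Config → Set
Fits r ρ []            = ⊤
Fits r ρ ((g , f) ∷ x) = bit g + f ≤ ρ × Fits r (r ∸ f) x

+-tight : ∀ {a b c d} → a ≤ c → b ≤ d → a + b ≡ c + d → a ≡ c × b ≡ d
+-tight {a} {b} {c} {d} a≤c b≤d eq = a≡c , +-cancelˡ-≡ a b d (trans eq (cong (_+ d) (sym a≡c)))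
  where
  a≡c : a ≡ c
  a≡c = ≤-antisym a≤c (+-cancelʳ-≤ d c a (≤-trans (≤-reflexive (sym eq)) (+-monoʳ-≤ a b≤d)))

-- If every part is counted, none of the truncations cuts anything off. This recovers condition (2)
-- from the mark counts.
load≡total⇒Fits : ∀ r ρ x → load r ρ x ≡ total x → Fits r ρ x
load≡total⇒Fits r ρ []            eq = tt
load≡total⇒Fits r ρ ((g , f) ∷ x) eq
  with +-tight (+-mono-≤ (m⊓n≤m (bit g) ρ) (m⊓n≤m f _)) (load≤total r _ x) eq
... | eqh , eqt with +-tight (m⊓n≤m (bit g) ρ) (m⊓n≤m f _) eqh
... | eqg , eqf =
    ≤-trans (+-mono-≤ (≤-reflexive (sym eqg)) (m⊓n≡m⇒m≤n eqf)) (≤-reflexive (m+[n∸m]≡n (m⊓n≤n (bit g) ρ)))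
  , subst (λ e → Fits r (r ∸ e) x) eqf (load≡total⇒Fits r _ x eqt)

weight : ℕ → Config → ℕ
weight s []            = 0
weight s ((g , f) ∷ x) = bit g * suc s + f * suc (suc s) + weight (suc (suc s)) x

weight-shift : ∀ s v → weight s (plain (shift v)) ≡ weight s (plain v) + 2 * pairs v
weight-shift s []              = refl
weight-shift s (zero ∷ v)      = weight-shift (suc (suc s)) v
weight-shift s (suc p ∷ [])    = lemma p s
  where
  lemma : ∀ p s → p * suc (suc s) + (1 * suc (suc (suc (suc s))) + 0) ≡ suc p * suc (suc s) + 0 + 2 * 1
  lemma = solve-∀
weight-shift s (suc p ∷ q ∷ v) =
  trans (cong (λ w → p * suc (suc s) + (suc q * suc (suc (suc (suc s))) + w)) (weight-shift (suc (suc (suc (suc s)))) v))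
        (lemma p q s _ (pairs v))
  where
  lemma : ∀ p q s w n →
    p * suc (suc s) + (suc q * suc (suc (suc (suc s))) + (w + 2 * n)) ≡
    suc p * suc (suc s) + (q * suc (suc (suc (suc s))) + w) + 2 * suc n
  lemma = solve-∀

weight-θ : ∀ s x → weight s (plain (proj₂ (θ x))) ≡ weight s x + sum (map (λ a → suc (2 * a)) (proj₁ (θ x)))
weight-θ s []                = refl
weight-θ s ((false , f) ∷ x) =
  trans (cong (f * suc (suc s) +_) (weight-θ (suc (suc s)) x)) (sym (+-assoc (f * suc (suc s)) _ _))
weight-θ s ((true  , f) ∷ x) =
  trans (cong (suc f * suc (suc s) +_) (trans (weight-shift (suc (suc s)) (proj₂ (θ x))) (cong (_+ 2 * pairs (proj₂ (θ x))) (weight-θ (suc (suc s)) x))))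
        (lemma f s _ _ (pairs (proj₂ (θ x))))
  where
  lemma : ∀ f s w a n →
    suc f * suc (suc s) + (w + a + 2 * n) ≡ 1 * suc s + f * suc (suc s) + w + (suc (2 * n) + a)
  lemma = solve-∀

-- Sequences as lists of parts

consOdd : Bool → ℕ → List Part → List Part
consOdd true  s ps = part (suc s) true ∷ ps
consOdd false s ps = ps

toParts : ℕ → Config → List Part
toParts s []            = []
toParts s ((g , f) ∷ x) = consOdd g s (replicate f (part (suc (suc s)) false) ++ toParts (suc (suc s)) x)

GPart : Part → Set
GPart p = T (overOdd p ∨ plainEven p)

parity : ∀ s → isEven s ≡ true → isOdd s ≡ false × isOdd (suc s) ≡ true × isEven (suc s) ≡ false
parity zero          ev = refl , refl , refl
parity (suc (suc s)) ev = parity s ev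

consOdd-All : ∀ {P : Part → Set} g {s ps} → (g ≡ true → P (part (suc s) true)) → All P ps → All P (consOdd g s ps)
consOdd-All true  h all = h refl ∷ all
consOdd-All false h all = all

toParts-All : ∀ {P : Part → Set} s x →
  (∀ u → isEven u ≡ isEven s → s ≤ u → P (part (suc u) true)) →
  (∀ u → isEven u ≡ isEven s → s ≤ u → P (part (suc (suc u)) false)) → All P (toParts s x)
toParts-All s []            o e = []
toParts-All s ((g , f) ∷ x) o e = consOdd-All g (λ _ → o s refl ≤-refl)
  (All.++⁺ (All.replicate⁺ f (e s refl ≤-refl))
       (toParts-All (suc (suc s)) x (λ u eq le → o u eq (≤-trans (m≤n+m s 2) le)) (λ u eq le → e u eq (≤-trans (m≤n+m s 2) le))))

toParts-> : ∀ s x → All (λ p → s < size p) (toParts s x)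
toParts-> s x = toParts-All s x (λ _ _ → s≤s) (λ _ _ le → s≤s (m≤n⇒m≤1+n le))

toParts-G : ∀ x → All GPart (toParts 0 x)
toParts-G x = toParts-All 0 x odd even
  where
  odd : ∀ u → isEven u ≡ true → 0 ≤ u → GPart (part (suc u) true)
  odd u ev _ rewrite proj₁ (proj₂ (parity u ev)) = tt
  even : ∀ u → isEven u ≡ true → 0 ≤ u → GPart (part (suc (suc u)) false)
  even u ev _ rewrite ev = tt

toParts-plain : ∀ s v → isEven s ≡ true → All (T ∘ plainEven) (toParts s (plain v))
toParts-plain s []      ev = []
toParts-plain s (f ∷ v) ev =
  All.++⁺ (All.replicate⁺ f (Equivalence.from T-≡ ev)) (toParts-plain (suc (suc s)) v ev)

key≤ : ∀ p → key p ≤ 2 * size p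
key≤ (part s true)  = m∸n≤m (2 * s) 1
key≤ (part s false) = ≤-refl

≤key : ∀ p → 2 * size p ∸ 1 ≤ key p
≤key (part s true)  = ≤-refl
≤key (part s false) = m∸n≤m (2 * s) 1

key-< : ∀ p q → size p < size q → key p < key q
key-< p q lt = begin-strict
  key p             ≤⟨ key≤ p ⟩
  2 * size p        <⟨ n<1+n _ ⟩
  1 + 2 * size p    ≡⟨ cong (_∸ 1) (*-suc 2 (size p)) ⟨
  2 * suc (size p) ∸ 1 ≤⟨ ∸-monoˡ-≤ 1 (*-monoʳ-≤ 2 lt) ⟩
  2 * size q ∸ 1    ≤⟨ ≤key q ⟩
  key q             ∎
  where open ≤-Reasoning

AdjOK-< : ∀ p q → size p < size q → AdjOK p q
AdjOK-< p q lt = <⇒≤ (key-< p q lt) , λ _ → key-< p q lt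

¬AdjOK-> : ∀ p q → size q < size p → ¬ AdjOK p q
¬AdjOK-> p q lt (le , _) = <⇒≱ (key-< q p lt) le

toParts-sorted : ∀ s x → AllPairs AdjOK (toParts s x)
toParts-sorted s []            = []
toParts-sorted s ((g , f) ∷ x) = odd g (evens f)
  where
  E = part (suc (suc s)) false
  tail> : All (λ p → suc (suc s) < size p) (toParts (suc (suc s)) x)
  tail> = toParts-> (suc (suc s)) x
  evens : ∀ f → AllPairs AdjOK (replicate f E ++ toParts (suc (suc s)) x)
  evens zero    = toParts-sorted (suc (suc s)) x
  evens (suc f) = All.++⁺ (All.replicate⁺ f (≤-refl , λ ())) (All.map (λ {q} → AdjOK-< E q) tail>) ∷ evens f
  odd : ∀ g → AllPairs AdjOK (replicate f E ++ toParts (suc (suc s)) x) →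
    AllPairs AdjOK (consOdd g s (replicate f E ++ toParts (suc (suc s)) x))
  odd false ap = ap
  odd true  ap = All.map (λ {q} → AdjOK-< (part (suc s) true) q)
    (All.++⁺ (All.replicate⁺ f ≤-refl) (All.map (<-trans (n<1+n _)) tail>)) ∷ ap

length-toParts : ∀ s x → length (toParts s x) ≡ total x
length-toParts s []                = refl
length-toParts s ((g , f) ∷ x) = trans (odd g) (sym (+-assoc (bit g) f (total x)))
  where
  E = part (suc (suc s)) false
  evens : length (replicate f E ++ toParts (suc (suc s)) x) ≡ f + total x
  evens = trans (length-++ (replicate f E)) (cong₂ _+_ (length-replicate f) (length-toParts (suc (suc s)) x))
  odd : ∀ g → length (consOdd g s (replicate f E ++ toParts (suc (suc s)) x)) ≡ bit g + (f + total x)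
  odd false = evens
  odd true  = cong suc evens

∣toParts∣ : ∀ s x → ∣ toParts s x ∣ₚ ≡ weight s x
∣toParts∣ s []            = refl
∣toParts∣ s ((g , f) ∷ x) = trans (odd g) (sym (+-assoc (bit g * suc s) (f * suc (suc s)) _))
  where
  w = weight (suc (suc s)) x
  ps : ℕ → List Part
  ps f = replicate f (part (suc (suc s)) false) ++ toParts (suc (suc s)) x
  evens : ∀ f → ∣ ps f ∣ₚ ≡ f * suc (suc s) + w
  evens zero    = ∣toParts∣ (suc (suc s)) x
  evens (suc f) = trans (cong (suc (suc s) +_) (evens f)) (sym (+-assoc (suc (suc s)) (f * suc (suc s)) w))
  odd : ∀ g → ∣ consOdd g s (ps f) ∣ₚ ≡ bit g * suc s + (f * suc (suc s) + w)
  odd false = evens f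
  odd true  = cong₂ _+_ (sym (+-identityʳ (suc s))) (evens f)

-- Frequencies of the parts of a sequence

≡ᵇ-refl : ∀ n → (n ≡ᵇ n) ≡ true
≡ᵇ-refl n = Equivalence.to T-≡ (≡⇒≡ᵇ n n refl)

≢⇒≡ᵇ-false : ∀ {m n} → m ≢ n → (m ≡ᵇ n) ≡ false
≢⇒≡ᵇ-false {m} {n} m≢n = ¬-not (λ eq → m≢n (≡ᵇ⇒≡ m n (Equivalence.from T-≡ eq)))

count-none : ∀ {A : Set} {P : A → Bool} xs → All (λ x → P x ≡ false) xs → count P xs ≡ 0
count-none []       []         = refl
count-none (x ∷ xs) (px ∷ pxs) rewrite px = count-none xs pxs

fN-consOdd : ∀ u g s ps → fN u (consOdd g s ps) ≡ fN u ps
fN-consOdd u false s ps = refl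
fN-consOdd u true  s ps rewrite ∧-zeroʳ (suc s ≡ᵇ u) = refl

fO-replicate : ∀ u f s ps → fO u (replicate f (part s false) ++ ps) ≡ fO u ps
fO-replicate u zero    s ps = refl
fO-replicate u (suc f) s ps rewrite ∧-zeroʳ (s ≡ᵇ u) = fO-replicate u f s ps

fN-replicate-≢ : ∀ u f s ps → s ≢ u → fN u (replicate f (part s false) ++ ps) ≡ fN u ps
fN-replicate-≢ u zero    s ps s≢u = refl
fN-replicate-≢ u (suc f) s ps s≢u rewrite ≢⇒≡ᵇ-false s≢u = fN-replicate-≢ u f s ps s≢u

fN-replicate-≡ : ∀ f s ps → fN s (replicate f (part s false) ++ ps) ≡ f + fN s ps
fN-replicate-≡ zero    s ps = refl
fN-replicate-≡ (suc f) s ps rewrite ≡ᵇ-refl s = cong suc (fN-replicate-≡ f s ps)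

fO-consOdd-≢ : ∀ u g s ps → suc s ≢ u → fO u (consOdd g s ps) ≡ fO u ps
fO-consOdd-≢ u false s ps s≢u = refl
fO-consOdd-≢ u true  s ps s≢u rewrite ≢⇒≡ᵇ-false s≢u = refl

fO-consOdd-≡ : ∀ g s ps → fO (suc s) (consOdd g s ps) ≡ bit g + fO (suc s) ps
fO-consOdd-≡ false s ps = refl
fO-consOdd-≡ true  s ps rewrite ≡ᵇ-refl s = refl

fN-toParts-≤ : ∀ u s x → u ≤ s → fN u (toParts s x) ≡ 0
fN-toParts-≤ u s x u≤s = count-none (toParts s x) (All.map none (toParts-> s x))
  where
  none : ∀ {p} → s < size p → (size p ≡ᵇ u) ∧ not (over p) ≡ false
  none lt rewrite ≢⇒≡ᵇ-false (λ eq → <⇒≢ (≤-<-trans u≤s lt) (sym eq)) = refl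

fO-toParts-≤ : ∀ u s x → u ≤ s → fO u (toParts s x) ≡ 0
fO-toParts-≤ u s x u≤s = count-none (toParts s x) (All.map none (toParts-> s x))
  where
  none : ∀ {p} → s < size p → (size p ≡ᵇ u) ∧ over p ≡ false
  none lt rewrite ≢⇒≡ᵇ-false (λ eq → <⇒≢ (≤-<-trans u≤s lt) (sym eq)) = refl

at : ℕ → Config → Bool × ℕ
at t       []      = false , 0
at zero    (a ∷ x) = a
at (suc t) (a ∷ x) = at t x

+-suc₂ : ∀ m n → m + suc (suc n) ≡ suc (suc (m + n))
+-suc₂ m n = trans (+-suc m (suc n)) (cong suc (+-suc m n))

-- 2 t + s, in the form that unfolds along toParts
off : ℕ → ℕ → ℕ
off zero    s = s
off (suc t) s = off t (suc (suc s))

off≡ : ∀ t s → off t s ≡ 2 * t + s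
off≡ zero    s = refl
off≡ (suc t) s = trans (off≡ t (suc (suc s))) (trans (+-suc₂ (2 * t) s) (cong (_+ s) (sym (*-suc 2 t))))

≤off : ∀ t s → s ≤ off t s
≤off zero    s = ≤-refl
≤off (suc t) s = ≤-trans (m≤n+m s 2) (≤off t (suc (suc s)))

fN-toParts : ∀ t s x → fN (suc (suc (off t s))) (toParts s x) ≡ proj₂ (at t x)
fN-toParts t       s []            = refl
fN-toParts zero    s ((g , f) ∷ x) = begin
  fN u (consOdd g s (replicate f (part u false) ++ toParts u x)) ≡⟨ fN-consOdd u g s _ ⟩
  fN u (replicate f (part u false) ++ toParts u x)               ≡⟨ fN-replicate-≡ f u _ ⟩
  f + fN u (toParts u x)                                         ≡⟨ cong (f +_) (fN-toParts-≤ u u x ≤-refl) ⟩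
  f + 0                                                          ≡⟨ +-identityʳ f ⟩
  f                                                              ∎
  where
  open ≡-Reasoning
  u = suc (suc s)
fN-toParts (suc t) s ((g , f) ∷ x) =
  trans (fN-consOdd _ g s _) (trans (fN-replicate-≢ _ f (suc (suc s)) _ (<⇒≢ (s≤s (m≤n⇒m≤1+n (≤off t _))))) (fN-toParts t (suc (suc s)) x))

fO-toParts : ∀ t s x → fO (suc (off t s)) (toParts s x) ≡ bit (proj₁ (at t x))
fO-toParts t       s []            = refl
fO-toParts zero    s ((g , f) ∷ x) = begin
  fO (suc s) (consOdd g s (replicate f (part u false) ++ toParts u x)) ≡⟨ fO-consOdd-≡ g s _ ⟩
  bit g + fO (suc s) (replicate f (part u false) ++ toParts u x)       ≡⟨ cong (bit g +_) (fO-replicate (suc s) f u _) ⟩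
  bit g + fO (suc s) (toParts u x)                                     ≡⟨ cong (bit g +_) (fO-toParts-≤ (suc s) u x (n≤1+n _)) ⟩
  bit g + 0                                                            ≡⟨ +-identityʳ _ ⟩
  bit g                                                                ∎
  where
  open ≡-Reasoning
  u = suc (suc s)
fO-toParts (suc t) s ((g , f) ∷ x) =
  trans (fO-consOdd-≢ _ g s _ (<⇒≢ (s≤s (≤-trans (n≤1+n _) (≤off t _))))) (trans (fO-replicate _ f (suc (suc s)) _) (fO-toParts t (suc (suc s)) x))

bit-injective : ∀ {a b} → bit a ≡ bit b → a ≡ b
bit-injective {true}  {true}  eq = refl
bit-injective {false} {false} eq = refl

consOdd-injective : ∀ g s {ps qs} → consOdd g s ps ≡ consOdd g s qs → ps ≡ qs
consOdd-injective true  s eq = ∷-injectiveʳ eq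
consOdd-injective false s eq = eq

toParts≡[] : ∀ s x → Trimmed (false , 0) x → toParts s x ≡ [] → x ≡ []
toParts≡[] s []                    tx       eq = refl
toParts≡[] s ((false , zero) ∷ x)  (z , tx) eq = contradiction refl (z (toParts≡[] (suc (suc s)) x tx eq))

toParts-injective : ∀ s x y → Trimmed (false , 0) x → Trimmed (false , 0) y → toParts s x ≡ toParts s y → x ≡ y
toParts-injective s [] y _ ty eq = sym (toParts≡[] s y ty (sym eq))
toParts-injective s (a ∷ x) [] tx _ eq = toParts≡[] s (a ∷ x) tx eq
toParts-injective s x₀@((g , f) ∷ x) y₀@((g′ , f′) ∷ y) (_ , tx) (_ , ty) eq
  with bit-injective {g} {g′} (trans (sym (fO-toParts 0 s x₀)) (trans (cong (fO (suc s)) eq) (fO-toParts 0 s y₀)))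
     | trans (sym (fN-toParts 0 s x₀)) (trans (cong (fN (suc (suc s))) eq) (fN-toParts 0 s y₀))
... | refl | refl = cong ((g , f) ∷_) (toParts-injective (suc (suc s)) x y tx ty
  (++-cancelˡ (replicate f (part (suc (suc s)) false)) _ _ (consOdd-injective g s eq)))

-- Only the size of a part is inspected: in 𝔾 its parity determines the overline.
add : ℕ → Config → Config
add 0                   x             = x
add 1                   []            = (true , 0) ∷ []
add 1                   ((_ , f) ∷ x) = (true , f) ∷ x
add 2                   []            = (false , 1) ∷ []
add 2                   ((g , f) ∷ x) = (g , suc f) ∷ x
add (suc (suc (suc n))) []            = (false , 0) ∷ add (suc n) []
add (suc (suc (suc n))) (a ∷ x)       = a ∷ add (suc n) x

fromParts : List Part → Config
fromParts []       = []
fromParts (p ∷ ps) = add (size p) (fromParts ps)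

add≢[] : ∀ n x → add (suc n) x ≢ []
add≢[] zero          []      ()
add≢[] zero          (a ∷ x) ()
add≢[] (suc zero)    []      ()
add≢[] (suc zero)    (a ∷ x) ()
add≢[] (suc (suc n)) []      ()
add≢[] (suc (suc n)) (a ∷ x) ()

add-trimmed : ∀ n x → Trimmed (false , 0) x → Trimmed (false , 0) (add n x)
add-trimmed 0 x tx = tx
add-trimmed 1 [] tx = (λ _ ()) , tt
add-trimmed 1 (a ∷ x) (_ , tx) = (λ _ ()) , tx
add-trimmed 2 [] tx = (λ _ ()) , tt
add-trimmed 2 (a ∷ x) (_ , tx) = (λ _ ()) , tx
add-trimmed (suc (suc (suc n))) [] tx = (λ eq → contradiction eq (add≢[] n [])) , add-trimmed (suc n) [] tx
add-trimmed (suc (suc (suc n))) (a ∷ x) (_ , tx) = (λ eq → contradiction eq (add≢[] n x)) , add-trimmed (suc n) x tx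

fromParts-trimmed : ∀ ps → Trimmed (false , 0) (fromParts ps)
fromParts-trimmed []       = tt
fromParts-trimmed (p ∷ ps) = add-trimmed (size p) _ (fromParts-trimmed ps)

GPart-odd : ∀ s b → isEven s ≡ true → GPart (part (suc s) b) → b ≡ true
GPart-odd s true  ev gp = refl
GPart-odd s false ev gp rewrite proj₂ (proj₂ (parity s ev)) = contradiction gp λ ()

GPart-even : ∀ s b → isEven s ≡ true → GPart (part s b) → b ≡ false
GPart-even s false ev gp = refl
GPart-even s true  ev gp rewrite proj₁ (parity s ev) = contradiction gp λ ()

-- The new part is at most every part present, so the positions passed on the way are empty: a
-- smaller part, or a second copy of the overlined part, would contradict the order assumed between
-- the new part and the first part of the list.
toParts-add : ∀ n s {m} b x → m ≡ suc n + s → isEven s ≡ true → GPart (part m b) →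
  All (AdjOK (part m b)) (toParts s x) → toParts s (add (suc n) x) ≡ part m b ∷ toParts s x
toParts-add zero s b x refl ev gp adj with GPart-odd s b ev gp
toParts-add zero s b []                refl ev gp adj            | refl = refl
toParts-add zero s b ((true  , f) ∷ x) refl ev gp ((_ , lt) ∷ _) | refl = contradiction (lt refl) (<-irrefl refl)
toParts-add zero s b ((false , f) ∷ x) refl ev gp adj            | refl = refl
toParts-add (suc zero) s b x refl ev gp adj with GPart-even (suc (suc s)) b ev gp
toParts-add (suc zero) s b []                refl ev gp adj      | refl = refl
toParts-add (suc zero) s b ((true  , f) ∷ x) refl ev gp (ok ∷ _) | refl =
  contradiction ok (¬AdjOK-> (part (suc (suc s)) false) (part (suc s) true) ≤-refl)
toParts-add (suc zero) s b ((false , f) ∷ x) refl ev gp adj      | refl = refl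
toParts-add (suc (suc n)) s b [] eq ev gp adj =
  toParts-add n (suc (suc s)) b [] (trans eq (sym (cong suc (+-suc₂ n s)))) ev gp []
toParts-add (suc (suc n)) s b ((true , f) ∷ x) refl ev gp (ok ∷ _) =
  contradiction ok (¬AdjOK-> (part _ b) (part (suc s) true) (s≤s (s≤s (m≤n+m s (suc n)))))
toParts-add (suc (suc n)) s b ((false , suc f) ∷ x) refl ev gp (ok ∷ _) =
  contradiction ok (¬AdjOK-> (part _ b) (part (suc (suc s)) false) (s≤s (s≤s (s≤s (m≤n+m s n)))))
toParts-add (suc (suc n)) s b ((false , zero) ∷ x) eq ev gp adj =
  toParts-add n (suc (suc s)) b x (trans eq (sym (cong suc (+-suc₂ n s)))) ev gp adj

toParts-fromParts : ∀ ps → All (λ p → 1 ≤ size p) ps → All GPart ps → AllPairs AdjOK ps →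
  toParts 0 (fromParts ps) ≡ ps
toParts-fromParts [] _ _ _ = refl
toParts-fromParts (part (suc n) b ∷ ps) (_ ∷ pos) (gp ∷ gps) (adj ∷ adjs)
  with toParts-fromParts ps pos gps adjs
... | ih = trans (toParts-add n 0 b (fromParts ps) (cong suc (sym (+-identityʳ n))) refl gp (subst (All _) (sym ih) adj))
                 (cong (part (suc n) b ∷_) ih)

-- The Göllnitz–Gordon marking on 𝔾

cnt : ℕ → List ℕ → ℕ
cnt j = count (j ≡ᵇ_)

cum : ℕ → List ℕ → ℕ
cum zero    S = 0
cum (suc r) S = cum r S + cnt (suc r) S

cnt-∷ : ∀ j m S → cnt j (m ∷ S) ≡ cnt j (m ∷ []) + cnt j S
cnt-∷ j m S with j ≡ᵇ m
... | true  = refl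
... | false = refl

cnt-≢ : ∀ {j m} → j ≢ m → cnt j (m ∷ []) ≡ 0
cnt-≢ j≢m rewrite ≢⇒≡ᵇ-false j≢m = refl

cnt-≡ : ∀ m → cnt m (m ∷ []) ≡ 1
cnt-≡ m rewrite ≡ᵇ-refl m = refl

cum-∷ : ∀ r m S → cum r (m ∷ S) ≡ cum r (m ∷ []) + cum r S
cum-∷ zero    m S = refl
cum-∷ (suc r) m S = trans (cong₂ _+_ (cum-∷ r m S) (cnt-∷ (suc r) m S)) (interchange (cum r (m ∷ [])) _ _ _)

cum-[] : ∀ r → cum r [] ≡ 0
cum-[] zero    = refl
cum-[] (suc r) = trans (+-identityʳ _) (cum-[] r)

cum-< : ∀ {r m} → r < m → cum r (m ∷ []) ≡ 0
cum-< {zero}  r<m = refl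
cum-< {suc r} r<m = cong₂ _+_ (cum-< (<-trans (n<1+n r) r<m)) (cnt-≢ (<⇒≢ r<m))

cum-single≤1 : ∀ r m → cum r (m ∷ []) ≤ 1
cum-single≤1 zero    m = z≤n
cum-single≤1 (suc r) m with suc r ≟ m
... | yes refl = ≤-reflexive (cong₂ _+_ (cum-< {r} ≤-refl) (cnt-≡ m))
... | no  r≢m  = ≤-trans (≤-reflexive (trans (cong (cum r (m ∷ []) +_) (cnt-≢ r≢m)) (+-identityʳ _))) (cum-single≤1 r m)

cum≤length : ∀ r S → cum r S ≤ length S
cum≤length r []      = ≤-reflexive (cum-[] r)
cum≤length r (m ∷ S) = ≤-trans (≤-reflexive (cum-∷ r m S)) (+-mono-≤ (cum-single≤1 r m) (cum≤length r S))

cum-full : ∀ r S → (∀ j → 1 ≤ j → j ≤ r → 1 ≤ cnt j S) → r ≤ cum r S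
cum-full zero    S full = z≤n
cum-full (suc r) S full = ≤-trans (≤-reflexive (+-comm 1 r))
  (+-mono-≤ (cum-full r S (λ j 1≤j j≤r → full j 1≤j (m≤n⇒m≤1+n j≤r))) (full (suc r) (s≤s z≤n) ≤-refl))

elem-true : ∀ j S → elemℕ j S ≡ true → 1 ≤ cnt j S
elem-true j (m ∷ S) eq with j ≡ᵇ m
... | true  = s≤s z≤n
... | false = elem-true j S eq

elem-false : ∀ j S → elemℕ j S ≡ false → cnt j S ≡ 0
elem-false j []      eq = refl
elem-false j (m ∷ S) eq with j ≡ᵇ m
... | false = elem-false j S eq

-- The local function of leastNotIn has no name outside Defs; it is recovered by unification.
mutual
  leastNotInFrom : List ℕ → ℕ → ℕ → ℕ
  leastNotInFrom = _

  leastNotIn-unfold : ∀ S → leastNotIn S ≡ leastNotInFrom S (length S) 1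
  leastNotIn-unfold S with length S | 1
  ... | n | r = refl

record Mex (S : List ℕ) (m : ℕ) : Set where
  field
    positive : 1 ≤ m
    absent   : cnt m S ≡ 0
    below    : ∀ j → 1 ≤ j → j < m → 1 ≤ cnt j S
open Mex

-- The fuel suffices by the pigeonhole principle: when it runs out, `r` exceeds the length of `S` by
-- one, so 1, ..., `r` cannot all occur in `S`.
leastNotInFrom-Mex : ∀ S n r → n + r ≡ suc (length S) → 1 ≤ r →
  (∀ j → 1 ≤ j → j < r → 1 ≤ cnt j S) → Mex S (leastNotInFrom S n r)
leastNotInFrom-Mex S zero r eq 1≤r full = record { positive = 1≤r ; absent = abs ; below = full }
  where
  abs : cnt r S ≡ 0
  abs with cnt r S in c
  ... | zero  = refl
  ... | suc k = contradiction
    (≤-trans (cum-full r S (λ j 1≤j j≤r → case j 1≤j (m≤n⇒m<n∨m≡n j≤r))) (cum≤length r S))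
    (<⇒≱ (≤-reflexive (sym eq)))
    where
    case : ∀ j → 1 ≤ j → j < r ⊎ j ≡ r → 1 ≤ cnt j S
    case j 1≤j (inj₁ j<r)  = full j 1≤j j<r
    case j 1≤j (inj₂ refl) = ≤-trans (s≤s z≤n) (≤-reflexive (sym c))
leastNotInFrom-Mex S (suc n) r eq 1≤r full with elemℕ r S in el
... | false = record { positive = 1≤r ; absent = elem-false r S el ; below = full }
... | true  = leastNotInFrom-Mex S n (suc r) (trans (+-suc n r) eq) (s≤s z≤n)
  (λ j 1≤j j<1+r → case j 1≤j (m≤n⇒m<n∨m≡n (≤-pred j<1+r)))
  where
  case : ∀ j → 1 ≤ j → j < r ⊎ j ≡ r → 1 ≤ cnt j S
  case j 1≤j (inj₁ j<r)  = full j 1≤j j<r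
  case j 1≤j (inj₂ refl) = elem-true j S el

leastNotIn-Mex : ∀ S → Mex S (leastNotIn S)
leastNotIn-Mex S = subst (Mex S) (sym (leastNotIn-unfold S))
  (leastNotInFrom-Mex S (length S) 1 (+-comm (length S) 1) ≤-refl (λ j 1≤j j<1 → contradiction 1≤j (<⇒≱ j<1)))

NoDup : List ℕ → Set
NoDup S = ∀ j → cnt j S ≤ 1

NoDup-∷ : ∀ {S m} → cnt m S ≡ 0 → NoDup S → NoDup (m ∷ S)
NoDup-∷ {S} {m} abs nd j with j ≟ m
... | yes refl = ≤-reflexive (trans (cnt-∷ j j S) (cong₂ _+_ (cnt-≡ j) abs))
... | no  j≢m  = ≤-trans (≤-reflexive (trans (cnt-∷ j m S) (cong (_+ cnt j S) (cnt-≢ j≢m)))) (nd j)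

-- As `S` has no repetitions, `cum r S` is the number of used marks among 1, ..., `r`. All are used
-- while `r` is below `m`; from `m` on, the missing `m` keeps the count below `r`.
cum-mex-cases : ∀ {S m} → Mex S m → NoDup S → ∀ r →
    (r < m × cum r S ≡ r × cum r (m ∷ []) ≡ 0)
  ⊎ (m ≤ r × cum r S < r × cum r (m ∷ []) ≡ 1)
cum-mex-cases mex nd zero = inj₁ (positive mex , refl , refl)
cum-mex-cases {S} {m} mex nd (suc r) with cum-mex-cases mex nd r
... | inj₂ (m≤r , lt , eq) = inj₂
  ( m≤n⇒m≤1+n m≤r
  , ≤-trans (+-mono-≤ lt (nd (suc r))) (≤-reflexive (+-comm r 1))
  , cong₂ _+_ eq (cnt-≢ (λ e → <⇒≢ (s≤s m≤r) (sym e))))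
... | inj₁ (r<m , full , eq) with m≤n⇒m<n∨m≡n r<m
...   | inj₁ r+1<m = inj₁
  ( r+1<m
  , trans (cong₂ _+_ full (≤-antisym (nd (suc r)) (below mex (suc r) (s≤s z≤n) r+1<m))) (+-comm r 1)
  , cum-< r+1<m)
...   | inj₂ refl = inj₂
  ( ≤-refl
  , s≤s (≤-reflexive (trans (cong₂ _+_ full (absent mex)) (+-identityʳ r)))
  , cong₂ _+_ eq (cnt-≡ (suc r)))

cum-mex : ∀ {S m} → Mex S m → NoDup S → ∀ r → cum r (m ∷ []) ≡ 1 ⊓ (r ∸ cum r S)
cum-mex {S} mex nd r with cum-mex-cases mex nd r
... | inj₁ (_ , full , eq) rewrite full | n∸n≡0 r = eq
... | inj₂ (_ , lt   , eq) rewrite ∸-suc lt = eq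

-- Marks of a sequence, position by position

mutual
  marksFrom : List Part → List (Part × ℕ) → ℕ → List Part → List ℕ
  marksFrom = _

  marks-∷ : ∀ p ps → marks (p ∷ ps) ≡ 1 ∷ marksFrom (p ∷ ps) ((p , 1) ∷ []) 1 ps
  -- Abstracting the arguments to variables lets unification determine `marksFrom` as the local
  -- function of `marks`.
  marks-∷ p ps with List (Part × ℕ) ∋ (p , 1) ∷ []
  ... | prev with List Part ∋ p ∷ ps | 1
  ... | whole | lm = refl

marks≡marksFrom : ∀ μ → marks μ ≡ marksFrom μ [] 0 μ
marks≡marksFrom []       = refl
marks≡marksFrom (p ∷ ps) = refl

partEq⇒≡ : ∀ p q → partEq p q ≡ true → p ≡ q
partEq⇒≡ (part s true) (part s′ true) eq with s ≡ᵇ s′ in e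
... | true = cong (λ u → part u true) (≡ᵇ⇒≡ s s′ (Equivalence.from T-≡ e))
partEq⇒≡ (part s true) (part s′ false) eq with s ≡ᵇ s′
partEq⇒≡ (part s true) (part s′ false) () | true
partEq⇒≡ (part s true) (part s′ false) () | false
partEq⇒≡ (part s false) (part s′ false) eq with s ≡ᵇ s′ in e
... | true = cong (λ u → part u false) (≡ᵇ⇒≡ s s′ (Equivalence.from T-≡ e))
partEq⇒≡ (part s false) (part s′ true) eq with s ≡ᵇ s′
partEq⇒≡ (part s false) (part s′ true) () | true
partEq⇒≡ (part s false) (part s′ true) () | false

occurs-¬G : ∀ p ps → ¬ GPart p → All GPart ps → occurs p ps ≡ false
occurs-¬G p []       ¬g []       = refl
occurs-¬G p (q ∷ ps) ¬g (g ∷ gs) with partEq p q in e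
... | true  = contradiction (subst GPart (sym (partEq⇒≡ p q e)) g) ¬g
... | false = occurs-¬G p ps ¬g gs

≤⇒≤ᵇ-true : ∀ {m n} → m ≤ n → (m ≤ᵇ n) ≡ true
≤⇒≤ᵇ-true m≤n = Equivalence.to T-≡ (≤⇒≤ᵇ m≤n)

>⇒≤ᵇ-false : ∀ {m n} → n < m → (m ≤ᵇ n) ≡ false
>⇒≤ᵇ-false {m} {n} n<m = ¬-not (λ eq → <⇒≱ n<m (≤ᵇ⇒≤ m n (Equivalence.from T-≡ eq)))

marksWithin2-≤ : ∀ u p m prev → u ≤ size p + 2 →
  marksWithin2 u ((p , m) ∷ prev) ≡ m ∷ marksWithin2 u prev
marksWithin2-≤ u p m prev le rewrite ≤⇒≤ᵇ-true le = refl

SizesUpTo : ℕ → List (Part × ℕ) → Set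
SizesUpTo s = All (λ qm → size (proj₁ qm) ≤ s)

-- An overlined `s+1` and everything before it lie outside the window of the next position; only the
-- parts `s+2` will be seen there. This is why `load` subtracts `e` but not `d`.
marksWithin2-far : ∀ s prev → SizesUpTo (suc s) prev → marksWithin2 (4 + s) prev ≡ []
marksWithin2-far s []               []        = refl
marksWithin2-far s ((q , m) ∷ prev) (le ∷ les)
  rewrite >⇒≤ᵇ-false {4 + s} {size q + 2} (≤-trans (s≤s (+-monoˡ-≤ 2 le)) (≤-reflexive (cong (2 +_) (+-comm s 2)))) =
  marksWithin2-far s prev les

-- When no earlier size exceeds `s`, lying at distance 1 below `s+1` and lying within 2 of `s+2`
-- both mean having size `s`. So the two kinds of parts at one position share a window.
marksAtDist-1 : ∀ s prev → SizesUpTo s prev → marksAtDist (suc s) 1 prev ≡ marksWithin2 (2 + s) prev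
marksAtDist-1 s []               []         = refl
marksAtDist-1 s ((q , m) ∷ prev) (le ∷ les) rewrite +-comm (size q) 1 | +-comm (size q) 2 with m≤n⇒m<n∨m≡n le
... | inj₁ lt rewrite ≢⇒≡ᵇ-false (λ e → <⇒≢ lt (sym e)) | >⇒≤ᵇ-false {2 + s} (s≤s (s≤s lt)) = marksAtDist-1 s prev les
... | inj₂ refl rewrite ≡ᵇ-refl (size q) | ≤⇒≤ᵇ-true (≤-refl {2 + size q}) = cong (m ∷_) (marksAtDist-1 (size q) prev les)

marksFrom-odd : ∀ whole prev lm s ps → isEven s ≡ true → SizesUpTo s prev →
  let m = leastNotIn (marksWithin2 (2 + s) prev) in
  marksFrom whole prev lm (part (suc s) true ∷ ps) ≡ m ∷ marksFrom whole ((part (suc s) true , m) ∷ prev) m ps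
marksFrom-odd whole []         lm s ps ev les = refl
marksFrom-odd whole prev@(_ ∷ _) lm s ps ev les rewrite sym (marksAtDist-1 s prev les) | proj₂ (proj₂ (parity s ev)) = refl

-- The exceptional mark `g` never arises: condition (iii) of rule (d) asks for a part that does not
-- occur in 𝔾.
marksFrom-even : ∀ whole prev lm s ps → All GPart whole → isEven s ≡ true →
  let m = leastNotIn (marksWithin2 (2 + s) prev) in
  marksFrom whole prev lm (part (2 + s) false ∷ ps) ≡ m ∷ marksFrom whole ((part (2 + s) false , m) ∷ prev) m ps
marksFrom-even whole []           lm s ps gs ev = refl
marksFrom-even whole prev@(_ ∷ _) lm s ps gs ev
  rewrite proj₁ (parity s ev)
        | occurs-¬G (part (suc s) false) whole (λ g → contradiction (GPart-odd s false ev g) λ ()) gs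
        | occurs-¬G (part (2 + s) true) whole (λ g → contradiction (GPart-even (2 + s) true ev g) λ ()) gs
        | ∧-zeroʳ (lm ≡ᵇ leastPosIn (marksAtDist (2 + s) 2 prev) ∸ 1)
        | ∧-zeroʳ (2 ≤ᵇ leastPosIn (marksAtDist (2 + s) 2 prev)) = refl

⊓-step : ∀ r a f → (1 ⊓ (r ∸ a)) + f ⊓ (r ∸ (1 ⊓ (r ∸ a) + a)) ≡ suc f ⊓ (r ∸ a)
⊓-step r a f with a <? r
... | yes a<r rewrite ∸-suc a<r = refl
... | no  a≮r rewrite m≤n⇒m∸n≡0 (≮⇒≥ a≮r) | m≤n⇒m∸n≡0 (≮⇒≥ a≮r) = ⊓-zeroʳ f

window : ℕ → List (Part × ℕ) → List ℕ
window s prev = marksWithin2 (2 + s) prev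

module _ (whole : List Part) (allG : All GPart whole) (r : ℕ) where

  cum-marksFrom : ∀ s x prev lm → isEven s ≡ true → SizesUpTo s prev → NoDup (window s prev) →
    cum r (marksFrom whole prev lm (toParts s x)) ≡ load r (r ∸ cum r (window s prev)) x

  -- Two windows are followed at once: that of the current position, from which the marks are
  -- chosen, and that of the next position, which fills up with the same new marks. The inclusion of
  -- the second in the first passes distinctness on.
  cum-marksFrom-evens : ∀ f s x prev lm → isEven s ≡ true → SizesUpTo (2 + s) prev →
    NoDup (window s prev) → (∀ j → cnt j (window (2 + s) prev) ≤ cnt j (window s prev)) →
    let e = f ⊓ (r ∸ cum r (window s prev)) in
    cum r (marksFrom whole prev lm (replicate f (part (2 + s) false) ++ toParts (2 + s) x)) ≡
    e + load r (r ∸ (cum r (window (2 + s) prev) + e)) x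

  cum-marksFrom-evens zero s x prev lm ev le nd sub =
    trans (cum-marksFrom (2 + s) x prev lm ev le (λ j → ≤-trans (sub j) (nd j)))
          (cong (λ c → load r (r ∸ c) x) (sym (+-identityʳ (cum r (window (2 + s) prev)))))
  cum-marksFrom-evens (suc f) s x prev lm ev le nd sub = begin
    cum r (marksFrom whole prev lm (E ∷ ps))
      ≡⟨ cong (cum r) (marksFrom-even whole prev lm s ps allG ev) ⟩
    cum r (m ∷ marksFrom whole prev′ m ps)
      ≡⟨ cum-∷ r m _ ⟩
    δ + cum r (marksFrom whole prev′ m ps)
      ≡⟨ cong (δ +_) (cum-marksFrom-evens f s x prev′ m ev (≤-refl ∷ le) nd′ sub′) ⟩
    δ + (e′ + load r (r ∸ (cum r (window (2 + s) prev′) + e′)) x)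
      ≡⟨ +-assoc δ e′ _ ⟨
    δ + e′ + load r (r ∸ (cum r (window (2 + s) prev′) + e′)) x
      ≡⟨ cong (λ c → δ + e′ + load r (r ∸ c) x) b≡ ⟩
    δ + e′ + load r (r ∸ (b + (δ + e′))) x
      ≡⟨ cong (λ d → d + load r (r ∸ (b + d)) x) e≡ ⟩
    e + load r (r ∸ (b + e)) x ∎
    where
    open ≡-Reasoning
    E = part (2 + s) false
    ps = replicate f E ++ toParts (2 + s) x
    A = window s prev
    B = window (2 + s) prev
    m = leastNotIn A
    mex : Mex A m
    mex = leastNotIn-Mex A
    prev′ = (E , m) ∷ prev
    a = cum r A
    b = cum r B
    δ = cum r (m ∷ [])
    e = suc f ⊓ (r ∸ a)
    e′ = f ⊓ (r ∸ cum r (window s prev′))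
    A′≡ : window s prev′ ≡ m ∷ A
    A′≡ = marksWithin2-≤ (2 + s) E m prev (m≤m+n (2 + s) 2)
    B′≡ : window (2 + s) prev′ ≡ m ∷ B
    B′≡ = marksWithin2-≤ (4 + s) E m prev (≤-reflexive (cong (2 +_) (+-comm 2 s)))
    nd′ : NoDup (window s prev′)
    nd′ = subst NoDup (sym A′≡) (NoDup-∷ {A} (absent mex) nd)
    sub′ : ∀ j → cnt j (window (2 + s) prev′) ≤ cnt j (window s prev′)
    sub′ j rewrite A′≡ | B′≡ | cnt-∷ j m A | cnt-∷ j m B = +-monoʳ-≤ (cnt j (m ∷ [])) (sub j)
    e≡ : δ + e′ ≡ e
    e≡ rewrite A′≡ | cum-∷ r m A | cum-mex mex nd r = ⊓-step r a f
    b≡ : cum r (window (2 + s) prev′) + e′ ≡ b + (δ + e′)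
    b≡ = trans (cong (_+ e′) (trans (cong (cum r) B′≡) (trans (cum-∷ r m B) (+-comm δ b)))) (+-assoc b δ e′)

  cum-marksFrom s [] prev lm ev le nd = cum-[] r
  cum-marksFrom s ((false , f) ∷ x) prev lm ev le nd =
    trans (cum-marksFrom-evens f s x prev lm ev (All.map (λ h → ≤-trans h (m≤n+m s 2)) le) nd sub)
          (cong (λ c → e + load r (r ∸ (c + e)) x) (trans (cong (cum r) far) (cum-[] r)))
    where
    e = f ⊓ (r ∸ cum r (window s prev))
    far : window (2 + s) prev ≡ []
    far = marksWithin2-far s prev (All.map m≤n⇒m≤1+n le)
    sub : ∀ j → cnt j (window (2 + s) prev) ≤ cnt j (window s prev)
    sub j rewrite far = z≤n
  cum-marksFrom s ((true , f) ∷ x) prev lm ev le nd = begin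
    cum r (marksFrom whole prev lm (O ∷ ps))
      ≡⟨ cong (cum r) (marksFrom-odd whole prev lm s ps ev le) ⟩
    cum r (m ∷ marksFrom whole prev′ m ps)
      ≡⟨ cum-∷ r m _ ⟩
    δ + cum r (marksFrom whole prev′ m ps)
      ≡⟨ cong (δ +_) (cum-marksFrom-evens f s x prev′ m ev (All.map (λ h → ≤-trans h (n≤1+n _)) le′) nd′ sub′) ⟩
    δ + (e′ + load r (r ∸ (cum r (window (2 + s) prev′) + e′)) x)
      ≡⟨ cong (λ c → δ + (e′ + load r (r ∸ (c + e′)) x)) (trans (cong (cum r) far) (cum-[] r)) ⟩
    δ + (e′ + load r (r ∸ e′) x)
      ≡⟨ cong₂ (λ d e → d + (e + load r (r ∸ e) x)) δ≡ e≡ ⟩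
    d + (e + load r (r ∸ e) x)
      ≡⟨ +-assoc d e _ ⟨
    d + e + load r (r ∸ e) x ∎
    where
    open ≡-Reasoning
    O = part (suc s) true
    ps = replicate f (part (2 + s) false) ++ toParts (2 + s) x
    A = window s prev
    m = leastNotIn A
    mex : Mex A m
    mex = leastNotIn-Mex A
    prev′ = (O , m) ∷ prev
    a = cum r A
    δ = cum r (m ∷ [])
    d = 1 ⊓ (r ∸ a)
    e = f ⊓ (r ∸ a ∸ d)
    e′ = f ⊓ (r ∸ cum r (window s prev′))
    le′ : SizesUpTo (suc s) prev′
    le′ = ≤-refl ∷ All.map m≤n⇒m≤1+n le
    far : window (2 + s) prev′ ≡ []
    far = marksWithin2-far s prev′ le′
    A′≡ : window s prev′ ≡ m ∷ A
    A′≡ = marksWithin2-≤ (2 + s) O m prev (s≤s (≤-trans (n≤1+n _) (≤-reflexive (+-comm 2 s))))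
    nd′ : NoDup (window s prev′)
    nd′ = subst NoDup (sym A′≡) (NoDup-∷ {A} (absent mex) nd)
    sub′ : ∀ j → cnt j (window (2 + s) prev′) ≤ cnt j (window s prev′)
    sub′ j rewrite far = z≤n
    δ≡ : δ ≡ d
    δ≡ = cum-mex mex nd r
    e≡ : e′ ≡ e
    e≡ = cong (f ⊓_) (trans (cong (r ∸_) (trans (cong (cum r) A′≡) (trans (cum-∷ r m A) (trans (+-comm δ a) (cong (a +_) δ≡))))) (sym (∸-+-assoc r a d)))

cum-marks : ∀ r x → cum r (marks (toParts 0 x)) ≡ load r r x
cum-marks r x = begin
  cum r (marks (toParts 0 x))                        ≡⟨ cong (cum r) (marks≡marksFrom (toParts 0 x)) ⟩
  cum r (marksFrom (toParts 0 x) [] 0 (toParts 0 x)) ≡⟨ cum-marksFrom (toParts 0 x) (toParts-G x) r 0 x [] 0 refl [] (λ _ → z≤n) ⟩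
  load r (r ∸ cum r []) x                            ≡⟨ cong (λ c → load r (r ∸ c) x) (cum-[] r) ⟩
  load r r x                                         ∎
  where open ≡-Reasoning

-- The sets 𝔾, 𝔼 and 𝔻

isEven-off : ∀ t s → isEven (off t s) ≡ isEven s
isEven-off zero    s = refl
isEven-off (suc t) s = isEven-off t (suc (suc s))

off-0 : ∀ t → 2 * t ≡ off t 0
off-0 t = sym (trans (off≡ t 0) (+-identityʳ (2 * t)))

fO-even : ∀ t ps → All GPart ps → fO (off t 0) ps ≡ 0
fO-even t ps gs = count-none ps (All.map (λ {p} → none p) gs)
  where
  none : ∀ p → GPart p → (size p ≡ᵇ off t 0) ∧ over p ≡ false
  none (part s false) g = ∧-zeroʳ (s ≡ᵇ off t 0)
  none (part s true)  g with s ≡ᵇ off t 0 in e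
  ... | false = refl
  ... | true with ≡ᵇ⇒≡ s (off t 0) (Equivalence.from T-≡ e)
  ...   | refl = GPart-even (off t 0) true (isEven-off t 0) g

fN-odd : ∀ t ps → All GPart ps → fN (suc (off t 0)) ps ≡ 0
fN-odd t ps gs = count-none ps (All.map (λ {p} → none p) gs)
  where
  none : ∀ p → GPart p → (size p ≡ᵇ suc (off t 0)) ∧ not (over p) ≡ false
  none (part s true)  g = ∧-zeroʳ (s ≡ᵇ suc (off t 0))
  none (part s false) g with s ≡ᵇ suc (off t 0) in e
  ... | false = refl
  ... | true with ≡ᵇ⇒≡ s (suc (off t 0)) (Equivalence.from T-≡ e)
  ...   | refl = sym (GPart-odd (off t 0) false (isEven-off t 0) g)

headLoad : ℕ → Config → ℕ
headLoad t x = bit (proj₁ (at t x)) + proj₂ (at t x)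

Fits-head : ∀ r ρ x → Fits r ρ x → headLoad 0 x ≤ ρ
Fits-head r ρ []      fits       = z≤n
Fits-head r ρ (a ∷ x) (le , _) = le

Fits-window : ∀ r ρ x t → ρ ≤ r → Fits r ρ x → proj₂ (at t x) + headLoad (suc t) x ≤ r
Fits-window r ρ []            t       ρ≤r fits        = z≤n
Fits-window r ρ ((g , f) ∷ x) zero    ρ≤r (le , fits) =
  ≤-trans (+-monoʳ-≤ f (Fits-head r (r ∸ f) x fits))
          (≤-reflexive (m+[n∸m]≡n (≤-trans (m≤n+m f (bit g)) (≤-trans le ρ≤r))))
Fits-window r ρ ((g , f) ∷ x) (suc t) ρ≤r (le , fits) = Fits-window r (r ∸ f) x t (m∸n≤m r f) fits

fO1+fN2 : ∀ x → fO 1 (toParts 0 x) + fN 2 (toParts 0 x) ≡ headLoad 0 x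
fO1+fN2 x = cong₂ _+_ (fO-toParts 0 0 x) (fN-toParts 0 0 x)

toParts-InO : ∀ k i x → headLoad 0 x + 1 ≤ i → Fits k k x → InO (suc k) i (toParts 0 x)
toParts-InO k i x h fits =
    subst (λ n → n + 1 ≤ i) (sym (fO1+fN2 x)) h
  , bound
  -- Condition (3) is vacuous, as there are no non-overlined odd parts.
  , λ t 1≤ → contradiction (≤-trans 1≤ (≤-reflexive (odd t))) λ ()
  where
  ps = toParts 0 x
  odd : ∀ t → fN (2 * t + 1) ps ≡ 0
  odd t rewrite +-comm (2 * t) 1 | off-0 t = fN-odd t ps (toParts-G x)
  bound : ∀ t → fO (2 * t) ps + fN (2 * t) ps + fO (2 * t + 1) ps + fN (2 * t + 2) ps + 1 ≤ suc k
  bound t rewrite +-comm (2 * t) 1 | +-comm (2 * t) 2 | off-0 t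
    | fO-even t ps (toParts-G x) | fO-toParts t 0 x | fN-toParts t 0 x
    | +-assoc (fN (off t 0) ps) (bit (proj₁ (at t x))) (proj₂ (at t x))
    | +-comm (fN (off t 0) ps + headLoad t x) 1 = s≤s (go t)
    where
    go : ∀ t → fN (off t 0) ps + headLoad t x ≤ k
    go zero rewrite fN-toParts-≤ 0 0 x ≤-refl = Fits-head k k x fits
    go (suc t) rewrite trans (off≡ t 2) (trans (+-suc₂ (2 * t) 0) (cong (2 +_) (sym (off≡ t 0)))) | fN-toParts t 0 x =
      Fits-window k k x t ≤-refl fits

-- The offset `o`, the number of marks already passed, makes induction on the vector possible.
cum-sum : ∀ {m} (N : Vec ℕ m) o S → (∀ (r : Fin m) → cnt (suc (o + toℕ r)) S ≡ lookup N r) →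
  cum (o + m) S ≡ cum o S + Vec.sum N
cum-sum Vec.[] o S h = trans (cong (λ n → cum n S) (+-identityʳ o)) (sym (+-identityʳ (cum o S)))
cum-sum {suc m} (n Vec.∷ N) o S h = begin
  cum (o + suc m) S              ≡⟨ cong (λ j → cum j S) (+-suc o m) ⟩
  cum (suc o + m) S              ≡⟨ cum-sum N (suc o) S (λ r → trans (cong (λ j → cnt (suc j) S) (sym (+-suc o (toℕ r)))) (h (Fin.suc r))) ⟩
  cum o S + cnt (suc o) S + Vec.sum N ≡⟨ cong (λ c → cum o S + c + Vec.sum N) (trans (cong (λ j → cnt (suc j) S) (sym (+-identityʳ o))) (h Fin.zero)) ⟩
  cum o S + n + Vec.sum N        ≡⟨ +-assoc (cum o S) n (Vec.sum N) ⟩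
  cum o S + (n + Vec.sum N)      ∎
  where open ≡-Reasoning

GPart⇒SmallestOK : ∀ ps → All GPart ps → SmallestOK ps
GPart⇒SmallestOK []       []      = tt
GPart⇒SmallestOK (p ∷ ps) (g ∷ _) = g

-- Mark counts are differences of consecutive loads, so they carry over. Since the `N_r` add up to
-- the number of parts, every part has a mark at most `k`; hence `load` counts all of them and
-- condition (2) follows.
InG-transfer : ∀ k i N x y → (∀ r → load r r x ≡ load r r y) → total x ≡ total y → headLoad 0 x ≡ headLoad 0 y →
  InG (suc k) i N (toParts 0 x) → InG (suc k) i N (toParts 0 y)
InG-transfer k i N x y loads totals heads ((_ , (small , _) , _ , len , marked) , _) =
  ( (toParts-> 0 y , AllPairs⇒Linked (toParts-sorted 0 y))
  , toParts-InO k i y (subst (λ n → n + 1 ≤ i) (trans (fO1+fN2 x) heads) small) (load≡total⇒Fits k k y full)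
  , GPart⇒SmallestOK _ (toParts-G y)
  , trans len≡ len
  , λ r → trans (sym (markCounts (toℕ r))) (marked r))
  , toParts-G y
  where
  open ≡-Reasoning
  len≡ : length (toParts 0 y) ≡ length (toParts 0 x)
  len≡ = trans (length-toParts 0 y) (trans (sym totals) (sym (length-toParts 0 x)))
  cums : ∀ r → cum r (marks (toParts 0 x)) ≡ cum r (marks (toParts 0 y))
  cums r = trans (cum-marks r x) (trans (loads r) (sym (cum-marks r y)))
  markCounts : ∀ r → markCount (suc r) (toParts 0 x) ≡ markCount (suc r) (toParts 0 y)
  markCounts r = +-cancelˡ-≡ (cum r (marks (toParts 0 x))) _ _
    (trans (cums (suc r)) (cong (_+ markCount (suc r) (toParts 0 y)) (sym (cums r))))
  full : load k k y ≡ total y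
  full = begin
    load k k y                  ≡⟨ loads k ⟨
    load k k x                  ≡⟨ cum-marks k x ⟨
    cum k (marks (toParts 0 x)) ≡⟨ cum-sum N 0 _ marked ⟩
    Vec.sum N                   ≡⟨ len ⟨
    length (toParts 0 x)        ≡⟨ len≡ ⟨
    length (toParts 0 y)        ≡⟨ length-toParts 0 y ⟩
    total y                     ∎

-- At the first position an overlined 1 becomes a 2 and the shifts act on later positions only, so
-- condition (1) is preserved.
headLoad-θ : ∀ x → headLoad 0 x ≡ headLoad 0 (plain (proj₂ (θ x)))
headLoad-θ []                = refl
headLoad-θ ((false , f) ∷ x) = refl
headLoad-θ ((true  , f) ∷ x) = refl

-- The pairs are headed by the 1-marked parts. If there are no `N_r`, then there are no parts, which
-- agrees with `N₁` being 0.
N₁≡pairs : ∀ k i (N : Vec ℕ k) v → InG (suc k) i N (toParts 0 (plain v)) → N₁ N ≡ pairs v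
N₁≡pairs zero i Vec.[] v ((_ , _ , _ , len , _) , _) = sym (n≤0⇒n≡0 (begin
  pairs v                       ≡⟨ load-1≡pairs v ⟨
  load 1 1 (plain v)            ≤⟨ load≤total 1 1 (plain v) ⟩
  total (plain v)               ≡⟨ length-toParts 0 (plain v) ⟨
  length (toParts 0 (plain v))  ≡⟨ len ⟩
  0                             ∎))
  where open ≤-Reasoning
N₁≡pairs (suc k) i (n Vec.∷ N) v ((_ , _ , _ , _ , marked) , _) =
  trans (sym (marked Fin.zero)) (trans (cum-marks 1 (plain v)) (load-1≡pairs v))

plain-trimmed : ∀ v → Trimmed 0 v → Trimmed (false , 0) (plain v)
plain-trimmed []           tv       = tt
plain-trimmed (f ∷ [])     (z , tv) = (λ _ eq → z refl (cong proj₂ eq)) , tt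
plain-trimmed (f ∷ v@(_ ∷ _)) (z , tv) = (λ ()) , plain-trimmed v tv

plain-trimmed⁻ : ∀ v → Trimmed (false , 0) (plain v) → Trimmed 0 v
plain-trimmed⁻ []      tv       = tt
plain-trimmed⁻ (f ∷ v) (z , tv) = (λ { refl eq → z refl (cong (false ,_) eq) }) , plain-trimmed⁻ v tv

add-plain : ∀ n v → isEven n ≡ true → ∃ λ w → add n (plain v) ≡ plain w
add-plain 0 v ev = v , refl
add-plain 2 []      ev = 1 ∷ [] , refl
add-plain 2 (f ∷ v) ev = suc f ∷ v , refl
add-plain (suc (suc (suc n))) []      ev with add-plain (suc n) [] ev
... | w , eq = 0 ∷ w , cong ((false , 0) ∷_) eq
add-plain (suc (suc (suc n))) (f ∷ v) ev with add-plain (suc n) v ev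
... | w , eq = f ∷ w , cong ((false , f) ∷_) eq

fromParts-plain : ∀ ps → All (T ∘ plainEven) ps → ∃ λ w → fromParts ps ≡ plain w
fromParts-plain [] [] = [] , refl
fromParts-plain (part s false ∷ ps) (ev ∷ evs) with fromParts-plain ps evs
... | v , eq with add-plain s v (Equivalence.to T-≡ ev)
... | w , eq′ = w , trans (cong (add s) eq) eq′

open import Data.Integer as ℤ using (ℤ; +_; -[1+_])
import Data.Integer.Properties as ℤ

neg : ℕ → ℤ
neg a = -[1+ 2 * a ]

neg-injective : ∀ {a b} → neg a ≡ neg b → a ≡ b
neg-injective {a} {b} eq = *-cancelˡ-≡ a b 2 (ℤ.-[1+-injective eq)

-- A larger `a` gives a smaller integer, so the decreasing order of the recorded values is the
-- increasing order of η.
D-encode : ∀ N A → AllPairs _>_ A → All (_< N) A → InD N (map neg A)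
D-encode N A dec lt =
    AllPairs⇒Linked (AllPairs.map⁺ (AllPairs.map (λ b<a → ℤ.-<- (*-monoʳ-< 2 b<a)) dec))
  , All.map⁺ (All.map (λ {a} a<N → a , a<N , refl) lt)

D-decode : ∀ N η → InD N η → ∃ λ A → η ≡ map neg A × AllPairs _>_ A × All (_< N) A
D-decode N η (inc , odd) with values η odd
  where
  values : ∀ η → All (λ z → Σ ℕ λ a → a < N × z ≡ neg a) η → ∃ λ A → η ≡ map neg A × All (_< N) A
  values []      []                      = [] , refl , []
  values (_ ∷ η) ((a , a<N , refl) ∷ all) with values η all
  ... | A , refl , lt = a ∷ A , refl , a<N ∷ lt
... | A , refl , lt = A , refl
  , AllPairs.map (λ { (ℤ.-<- lt) → *-cancelˡ-< 2 _ _ lt }) (AllPairs.map⁻ (Linked⇒AllPairs ℤ.<-trans inc)) , lt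

∣neg∣ : ∀ A → ∣ map neg A ∣ᵢ ≡ ℤ.- (+ sum (map (λ a → suc (2 * a)) A))
∣neg∣ []      = refl
∣neg∣ (a ∷ A) = trans (cong (ℤ._+_ (neg a)) (∣neg∣ A))
  (sym (ℤ.neg-distrib-+ (+ suc (2 * a)) (+ sum (map (λ b → suc (2 * b)) A))))

-- The bijection transported to overpartitions

Θ : List Part → List ℤ × List Part
Θ μ = map neg (proj₁ (θ (fromParts μ))) , toParts 0 (plain (proj₂ (θ (fromParts μ))))

AdjOK-trans : ∀ {p q r} → AdjOK p q → AdjOK q r → AdjOK p r
AdjOK-trans (p≤q , p<q) (q≤r , _) = ≤-trans p≤q q≤r , λ o → <-≤-trans (p<q o) q≤r

InG⇒toParts : ∀ k i N μ → InG k i N μ → toParts 0 (fromParts μ) ≡ μ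
InG⇒toParts k i N μ (((pos , linked) , _) , gs) =
  toParts-fromParts μ pos gs (Linked⇒AllPairs (λ {p} {q} {r} → AdjOK-trans {p} {q} {r}) linked)

Θ-InG : ∀ k i N x → InG (suc k) i N (toParts 0 x) → InG (suc k) i N (toParts 0 (plain (proj₂ (θ x))))
Θ-InG k i N x = InG-transfer k i N x (plain (proj₂ (θ x))) (λ r → sym (load-θ r r x ≤-refl)) (sym (total-θ x)) (headLoad-θ x)

theorem5p1 : (k i : ℕ) → 1 ≤ i → i ≤ k →
    (N : Vec ℕ (k ∸ 1)) → Antitone N →
    Σ (List Part → List ℤ × List Part) λ Θ →
    (∀ μ → InG k i N μ → InD (N₁ N) (proj₁ (Θ μ)) × InE k i N (proj₂ (Θ μ)))
    × (∀ μ μ′ → InG k i N μ → InG k i N μ′ → Θ μ ≡ Θ μ′ → μ ≡ μ′)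
    × (∀ η ν → InD (N₁ N) η → InE k i N ν → Σ (List Part) λ μ → InG k i N μ × Θ μ ≡ (η , ν))
    × (∀ μ → InG k i N μ → + ∣ μ ∣ₚ ≡ ∣ proj₁ (Θ μ) ∣ᵢ ℤ.+ + ∣ proj₂ (Θ μ) ∣ₚ)
theorem5p1 zero    zero () _
theorem5p1 zero    (suc i) _ ()
theorem5p1 (suc k) i 1≤i i≤k N _ = Θ , into , injective , surjective , weights
  where
  into : ∀ μ → InG (suc k) i N μ → InD (N₁ N) (proj₁ (Θ μ)) × InE (suc k) i N (proj₂ (Θ μ))
  into μ μ∈G = D-encode (N₁ N) _ (θ-decreasing x) (subst (λ n → All (_< n) _) (sym (N₁≡pairs k i N v ν∈G)) (θ-< x))
             , ν∈G , toParts-plain 0 v refl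
    where
    x = fromParts μ
    v = proj₂ (θ x)
    ν∈G : InG (suc k) i N (toParts 0 (plain v))
    ν∈G = Θ-InG k i N x (subst (InG (suc k) i N) (sym (InG⇒toParts (suc k) i N μ μ∈G)) μ∈G)

  injective : ∀ μ μ′ → InG (suc k) i N μ → InG (suc k) i N μ′ → Θ μ ≡ Θ μ′ → μ ≡ μ′
  injective μ μ′ μ∈G μ′∈G eq = begin
    μ                       ≡⟨ InG⇒toParts (suc k) i N μ μ∈G ⟨
    toParts 0 (fromParts μ)  ≡⟨ cong (toParts 0) (θ-injective _ _ tx tx′ (cong₂ _,_ A≡ v≡)) ⟩
    toParts 0 (fromParts μ′) ≡⟨ InG⇒toParts (suc k) i N μ′ μ′∈G ⟩
    μ′                      ∎
    where
    open ≡-Reasoning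
    tx  = fromParts-trimmed μ
    tx′ = fromParts-trimmed μ′
    A≡ : proj₁ (θ (fromParts μ)) ≡ proj₁ (θ (fromParts μ′))
    A≡ = map-injective neg-injective (cong proj₁ eq)
    v≡ : proj₂ (θ (fromParts μ)) ≡ proj₂ (θ (fromParts μ′))
    v≡ = map-injective (cong proj₂) (toParts-injective 0 _ _
      (plain-trimmed _ (θ-trimmed _ tx)) (plain-trimmed _ (θ-trimmed _ tx′)) (cong proj₂ eq))

  surjective : ∀ η ν → InD (N₁ N) η → InE (suc k) i N ν → Σ (List Part) λ μ → InG (suc k) i N μ × Θ μ ≡ (η , ν)
  surjective η ν η∈D (ν∈G , evens) with D-decode (N₁ N) η η∈D | fromParts-plain ν evens
  ... | A , refl , dec , lt | w , x≡w = toParts 0 x , μ∈G , (begin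
      Θ (toParts 0 x)                    ≡⟨ cong (λ y → map neg (proj₁ (θ y)) , toParts 0 (plain (proj₂ (θ y)))) fromμ ⟩
      map neg (proj₁ (θ x)) , toParts 0 (plain (proj₂ (θ x))) ≡⟨ cong (λ p → map neg (proj₁ p) , toParts 0 (plain (proj₂ p))) θx≡ ⟩
      map neg A , toParts 0 (plain w)    ≡⟨ cong (map neg A ,_) ν≡ ⟩
      map neg A , ν                      ∎)
    where
    open ≡-Reasoning
    ν≡ : toParts 0 (plain w) ≡ ν
    ν≡ = trans (cong (toParts 0) (sym x≡w)) (InG⇒toParts (suc k) i N ν ν∈G)
    w∈G : InG (suc k) i N (toParts 0 (plain w))
    w∈G = subst (InG (suc k) i N) (sym ν≡) ν∈G
    tw : Trimmed 0 w
    tw = plain-trimmed⁻ w (subst (Trimmed (false , 0)) x≡w (fromParts-trimmed ν))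
    preimage : ∃ λ x → Trimmed (false , 0) x × θ x ≡ (A , w)
    preimage = θ-surjective (length w) w A ≤-refl tw dec (subst (λ n → All (_< n) A) (N₁≡pairs k i N w w∈G) lt)
    x = proj₁ preimage
    θx≡ : θ x ≡ (A , w)
    θx≡ = proj₂ (proj₂ preimage)
    w≡ : plain (proj₂ (θ x)) ≡ plain w
    w≡ = cong (plain ∘ proj₂) θx≡
    -- `θ` preserves loads, totals and the first position, so membership in 𝔾 can be pulled back
    -- along it.
    μ∈G : InG (suc k) i N (toParts 0 x)
    μ∈G = InG-transfer k i N (plain w) x
      (λ r → trans (cong (load r r) (sym w≡)) (load-θ r r x ≤-refl))
      (trans (cong total (sym w≡)) (total-θ x))
      (sym (trans (headLoad-θ x) (cong (headLoad 0) w≡))) w∈G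
    fromμ : fromParts (toParts 0 x) ≡ x
    fromμ = toParts-injective 0 _ x (fromParts-trimmed (toParts 0 x)) (proj₁ (proj₂ preimage)) (InG⇒toParts (suc k) i N (toParts 0 x) μ∈G)

  weights : ∀ μ → InG (suc k) i N μ → + ∣ μ ∣ₚ ≡ ∣ proj₁ (Θ μ) ∣ᵢ ℤ.+ + ∣ proj₂ (Θ μ) ∣ₚ
  weights μ μ∈G = begin
    + ∣ μ ∣ₚ                         ≡⟨ cong (λ ps → + ∣ ps ∣ₚ) (InG⇒toParts (suc k) i N μ μ∈G) ⟨
    + ∣ toParts 0 x ∣ₚ               ≡⟨ cong +_ (∣toParts∣ 0 x) ⟩
    + W                              ≡⟨ ℤ.+-identityˡ (+ W) ⟨
    -- The weight identity in ℕ has the sum `S` of the removed odd numbers on the side of ν;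
    -- inserting 0 as `- S + S` produces it together with the negative weight of η.
    + 0 ℤ.+ + W                      ≡⟨ cong (ℤ._+ + W) (ℤ.+-inverseˡ (+ S)) ⟨
    ℤ.- + S ℤ.+ + S ℤ.+ + W          ≡⟨ ℤ.+-assoc (ℤ.- + S) (+ S) (+ W) ⟩
    ℤ.- + S ℤ.+ + (S + W)            ≡⟨ cong (λ n → ℤ.- + S ℤ.+ + n) (+-comm S W) ⟩
    ℤ.- + S ℤ.+ + (W + S)            ≡⟨ cong₂ (λ z n → z ℤ.+ + n) (∣neg∣ A) (trans (∣toParts∣ 0 (plain (proj₂ (θ x)))) (weight-θ 0 x)) ⟨
    ∣ proj₁ (Θ μ) ∣ᵢ ℤ.+ + ∣ proj₂ (Θ μ) ∣ₚ ∎
    where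
    open ≡-Reasoning
    x = fromParts μ
    A = proj₁ (θ x)
    W = weight 0 x
    S = sum (map (λ a → suc (2 * a)) A)
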